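{- For all integers $t\ge 3$, we have \[ \mathscr{I}(W_{2t+1}) \le \frac{4t^2 + 6t}{3(2t+2)^2}.\]
   Context: All graphs are finite and simple. $W_{n}$ denotes the $n$-wheel, the join of the cycle $C_{n}$ with a single vertex $K_1$ (so $W_{2t+1}$ has $2t+2$ vertices). The Cartesian product $G \Box H$ has vertex set $V(G)\times V(H)$, with $(u,x)$ adjacent to $(v,y)$ if and only if either $u=v$ and $xy\in E(H)$, or $x=y$ and $uv\in E(G)$. Set $G^{\Box 1}=G$ and $G^{\Box k}=G^{\Box (k-1)}\Box G$ for $k\ge 2$. $\alpha(G)$ is the independence number of $G$. The independence ratio is $i(G)=\alpha(G)/|V(G)|$, and the ultimate independence ratio is $\mathscr{I}(G)=\lim_{m\to\infty} i(G^{\Box m})$; this limit exists because $i(G^{\Box (m+1)})\le i(G^{\Box m})$ for all $m$. -}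

module Defs where

open import Data.Bool.Base using (Bool; true; false; if_then_else_)
open import Data.Empty using (⊥)
open import Data.Fin.Base using (Fin; toℕ; combine; _↑ˡ_; _↑ʳ_)
open import Data.Fin.Properties as Fin using (*↔×; +↔⊎; 1↔⊤; all?; remQuot-combine)
open import Data.Fin.Subset using (Subset; _∈_; ∣_∣)
open import Data.Fin.Subset.Properties using (_∈?_; anySubset?; ∣p∣≤n)
import Data.Integer.Base as ℤ
import Data.Integer.Properties as ℤ
open import Data.Nat.Base
open import Data.Nat.Properties
open import Data.Product.Base using (_×_; _,_; ∃)
open import Data.Product.Function.NonDependent.Propositional using (_×-↔_)
open import Data.Rational.Unnormalised.Base as ℚ using (ℚᵘ; mkℚᵘ; 0ℚᵘ; Positive)
import Data.Rational.Unnormalised.Properties as ℚ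
open import Data.Sum.Base using (_⊎_; inj₁; inj₂; swap)
open import Data.Sum.Function.Propositional using (_⊎-↔_)
open import Data.Unit.Base using (⊤)
open import Data.Vec.Base using ([]; _∷_; lookup; tabulate)
open import Data.Vec.Properties using (lookup∘tabulate; lookup⇒[]=; []=⇒lookup)
open import Function.Base using (_∘_; id; _$_; it)
open import Function.Bundles using (_↔_; Inverse)
open import Function.Properties.Inverse using (↔-refl; ↔-sym; ↔-trans; ↔⇒↣)
open import Relation.Binary.Definitions using (Decidable; Symmetric)
open import Relation.Binary.PropositionalEquality
open import Relation.Nullary using (Dec; yes; no; does; ¬_; ¬?; contradiction)
open import Relation.Nullary.Decidable using (_×-dec_; _⊎-dec_; _→-dec_)

open import Algebra.Properties.CommutativeMonoid.Sum +-0-commutativeMonoid using (sum; ∑-comm; sum-cong-≗)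

-- Vertices are numbered by enum, so that sets of vertices can be represented
-- by Data.Fin.Subset.Subset order.
record Graph : Set₁ where
  field
    V          : Set
    order      : ℕ
    enum       : Fin order ↔ V
    Adj        : V → V → Set
    Adj?       : Decidable Adj
    sym-Adj    : Symmetric Adj
    irrefl-Adj : ∀ {v} → ¬ Adj v v

  vertex : Fin order → V
  vertex = Inverse.to enum

  _≟ᵥ_ : Decidable {A = V} _≡_
  _≟ᵥ_ = Fin.inj⇒≟ (↔⇒↣ (↔-sym enum))

open Graph using (order)

infixl 7 _□_

_□_ : Graph → Graph → Graph
G □ H = record
  { V          = G.V × H.V
  ; order      = G.order * H.order
  ; enum       = ↔-trans *↔× (G.enum ×-↔ H.enum)
  ; Adj        = λ (u , x) (v , y) → (u ≡ v × H.Adj x y) ⊎ (x ≡ y × G.Adj u v)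
  ; Adj?       = λ (u , x) (v , y) →
                   (u G.≟ᵥ v ×-dec H.Adj? x y) ⊎-dec (x H.≟ᵥ y ×-dec G.Adj? u v)
  ; sym-Adj    = λ { (inj₁ (refl , e)) → inj₁ (refl , H.sym-Adj e)
                   ; (inj₂ (refl , e)) → inj₂ (refl , G.sym-Adj e) }
  ; irrefl-Adj = λ { (inj₁ (_ , e)) → H.irrefl-Adj e ; (inj₂ (_ , e)) → G.irrefl-Adj e }
  }
  where
  module G = Graph G
  module H = Graph H

infixl 8 _^□_

_^□_ : Graph → (k : ℕ) → .{{NonZero k}} → Graph
G ^□ 1             = G
G ^□ suc (suc k)   = (G ^□ suc k) □ G

-- j ≡ i + 1 (mod n)
Next : ∀ {n} → Fin n → Fin n → Set
Next {n} i j = suc (toℕ i) ≡ toℕ j ⊎ (suc (toℕ i) ≡ n × toℕ j ≡ 0)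

next? : ∀ {n} → Decidable (Next {n})
next? {n} i j = (suc (toℕ i) ≟ toℕ j) ⊎-dec ((suc (toℕ i) ≟ n) ×-dec (toℕ j ≟ 0))

-- A cycle only for n ≥ 3; the requirement i ≢ j, automatic for n ≥ 2, makes
-- the definition total.
C : ℕ → Graph
C n = record
  { V          = Fin n
  ; order      = n
  ; enum       = ↔-refl
  ; Adj        = λ i j → i ≢ j × (Next i j ⊎ Next j i)
  ; Adj?       = λ i j → ¬? (i Fin.≟ j) ×-dec (next? i j ⊎-dec next? j i)
  ; sym-Adj    = λ (i≢j , e) → ≢-sym i≢j , swap e
  ; irrefl-Adj = λ (i≢i , _) → i≢i refl
  }

K₁ : Graph
K₁ = record
  { V          = ⊤
  ; order      = 1
  ; enum       = 1↔⊤
  ; Adj        = λ _ _ → ⊥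
  ; Adj?       = λ _ _ → no λ ()
  ; sym-Adj    = λ ()
  ; irrefl-Adj = λ ()
  }

join : Graph → Graph → Graph
join G H = record
  { V          = G.V ⊎ H.V
  ; order      = G.order + H.order
  ; enum       = ↔-trans +↔⊎ (G.enum ⊎-↔ H.enum)
  ; Adj        = Adj
  ; Adj?       = adj?
  ; sym-Adj    = λ {u} {v} → symm u v
  ; irrefl-Adj = λ {v} → irr v
  }
  where
  module G = Graph G
  module H = Graph H

  Adj : G.V ⊎ H.V → G.V ⊎ H.V → Set
  Adj (inj₁ u) (inj₁ v) = G.Adj u v
  Adj (inj₁ u) (inj₂ y) = ⊤
  Adj (inj₂ x) (inj₁ v) = ⊤
  Adj (inj₂ x) (inj₂ y) = H.Adj x y

  adj? : Decidable Adj
  adj? (inj₁ u) (inj₁ v) = G.Adj? u v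
  adj? (inj₁ u) (inj₂ y) = yes _
  adj? (inj₂ x) (inj₁ v) = yes _
  adj? (inj₂ x) (inj₂ y) = H.Adj? x y

  symm : ∀ u v → Adj u v → Adj v u
  symm (inj₁ u) (inj₁ v) = G.sym-Adj
  symm (inj₁ u) (inj₂ y) = id
  symm (inj₂ x) (inj₁ v) = id
  symm (inj₂ x) (inj₂ y) = H.sym-Adj

  irr : ∀ v → ¬ Adj v v
  irr (inj₁ v) = G.irrefl-Adj
  irr (inj₂ y) = H.irrefl-Adj

W : ℕ → Graph
W n = join K₁ (C n)

Independent : (G : Graph) → Subset (order G) → Set
Independent G S = ∀ i j → i ∈ S → j ∈ S → ¬ Graph.Adj G (Graph.vertex G i) (Graph.vertex G j)

independent? : ∀ G S → Dec (Independent G S)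
independent? G S = all? λ i → all? λ j →
  (i ∈? S) →-dec ((j ∈? S) →-dec ¬? (Graph.Adj? G (Graph.vertex G i) (Graph.vertex G j)))

HasIndependentSet : Graph → ℕ → Set
HasIndependentSet G k = ∃ λ S → Independent G S × ∣ S ∣ ≡ k

hasIndependentSet? : ∀ G k → Dec (HasIndependentSet G k)
hasIndependentSet? G k = anySubset? λ S → independent? G S ×-dec (∣ S ∣ ≟ k)

-- The largest k ≤ n satisfying P, or 0 if there is none.
greatest : {P : ℕ → Set} → (∀ k → Dec (P k)) → ℕ → ℕ
greatest P? zero    = zero
greatest P? (suc n) = if does (P? (suc n)) then suc n else greatest P? n

α : Graph → ℕ
α G = greatest (hasIndependentSet? G) (order G)

ratio : (G : Graph) → .{{NonZero (order G)}} → ℚᵘ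
ratio G = ℤ.+ α G ℚ./ order G

private
  greatest-sat : {P : ℕ → Set} (P? : ∀ k → Dec (P k)) → P 0 → ∀ n → P (greatest P? n)
  greatest-sat P? p₀ zero = p₀
  greatest-sat P? p₀ (suc n) with P? (suc n)
  ... | yes p = p
  ... | no  _ = greatest-sat P? p₀ n

  greatest-max : {P : ℕ → Set} (P? : ∀ k → Dec (P k)) →
                 ∀ n k → k ≤ n → P k → k ≤ greatest P? n
  greatest-max P? zero    k k≤n p = k≤n
  greatest-max P? (suc n) k k≤n p with P? (suc n)
  ... | yes _ = k≤n
  ... | no ¬p with m≤n⇒m<n∨m≡n k≤n
  ...   | inj₁ (s≤s k≤n′) = greatest-max P? n k k≤n′ p
  ...   | inj₂ refl       = contradiction p ¬p

α-attained : ∀ G → HasIndependentSet G (α G)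
α-attained G = greatest-sat (hasIndependentSet? G)
  (Sub.⊥ , (λ _ _ i∈⊥ → contradiction i∈⊥ Subₚ.∉⊥) , Subₚ.∣⊥∣≡0 (order G)) (order G)
  where
  import Data.Fin.Subset as Sub
  import Data.Fin.Subset.Properties as Subₚ

α-maximum : ∀ G S → Independent G S → ∣ S ∣ ≤ α G
α-maximum G S ind =
  greatest-max (hasIndependentSet? G) (order G) ∣ S ∣ (∣p∣≤n S) (S , ind , refl)

private
  ⟦_⟧ : Bool → ℕ
  ⟦ b ⟧ = if b then 1 else 0

  ∣∣-sum : ∀ {n} (S : Subset n) → ∣ S ∣ ≡ sum (⟦_⟧ ∘ lookup S)
  ∣∣-sum []          = refl
  ∣∣-sum (true  ∷ S) = cong suc (∣∣-sum S)
  ∣∣-sum (false ∷ S) = ∣∣-sum S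

  sum-++ : ∀ m {n} (f : Fin (m + n) → ℕ) →
           sum f ≡ sum (λ i → f (i ↑ˡ n)) + sum (λ j → f (m ↑ʳ j))
  sum-++ zero    f = refl
  sum-++ (suc m) f = trans (cong (f Fin.zero +_) (sum-++ m (f ∘ Fin.suc)))
                           (sym (+-assoc (f Fin.zero) _ _))

  sum-combine : ∀ m n (f : Fin (m * n) → ℕ) →
                sum f ≡ sum {m} (λ i → sum {n} (λ j → f (combine i j)))
  sum-combine zero    n f = refl
  sum-combine (suc m) n f = trans (sum-++ n f)
    (cong (sum (λ j → f (j ↑ˡ (m * n))) +_) (sum-combine m n (f ∘ (n ↑ʳ_))))

  sum-bound : ∀ {n} (f : Fin n → ℕ) b → (∀ i → f i ≤ b) → sum f ≤ n * b
  sum-bound {zero}  f b f≤b = z≤n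
  sum-bound {suc n} f b f≤b = +-mono-≤ (f≤b Fin.zero) (sum-bound (f ∘ Fin.suc) b (f≤b ∘ Fin.suc))

α-□ : ∀ G H → α (G □ H) ≤ order H * α G
α-□ G H with α-attained (G □ H)
... | S , ind , ∣S∣≡α = begin
  α (G □ H)                                                     ≡⟨ ∣S∣≡α ⟨
  ∣ S ∣                                                         ≡⟨ ∣∣-sum S ⟩
  sum (⟦_⟧ ∘ lookup S)                                          ≡⟨ sum-combine m n _ ⟩
  sum {m} (λ i → sum {n} (λ j → ⟦ lookup S (combine i j) ⟧))    ≡⟨ ∑-comm {m} {n} _ ⟩
  sum {n} (λ j → sum {m} (λ i → ⟦ lookup S (combine i j) ⟧))    ≤⟨ sum-bound _ (α G) layer ⟩
  n * α G                                                       ∎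
  where
  open ≤-Reasoning
  module G = Graph G
  module H = Graph H
  m = G.order
  n = H.order

  slice : Fin n → Subset m
  slice j = tabulate λ i → lookup S (combine i j)

  slice-∈ : ∀ j i → i ∈ slice j → combine i j ∈ S
  slice-∈ j i i∈ = lookup⇒[]= (combine i j) S
    (trans (sym (lookup∘tabulate _ i)) ([]=⇒lookup i∈))

  vertex-combine : ∀ i j → Graph.vertex (G □ H) (combine i j) ≡ (G.vertex i , H.vertex j)
  vertex-combine i j = cong (λ (u , x) → G.vertex u , H.vertex x) (remQuot-combine i j)

  slice-independent : ∀ j → Independent G (slice j)
  slice-independent j i i′ i∈ i′∈ e =
    ind (combine i j) (combine i′ j) (slice-∈ j i i∈) (slice-∈ j i′ i′∈)
      (subst₂ (Graph.Adj (G □ H)) (sym (vertex-combine i j)) (sym (vertex-combine i′ j))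
        (inj₂ (refl , e)))

  layer : ∀ j → sum {m} (λ i → ⟦ lookup S (combine i j) ⟧) ≤ α G
  layer j = begin
    sum {m} (λ i → ⟦ lookup S (combine i j) ⟧) ≡⟨ sum-cong-≗ {m} (λ i → cong ⟦_⟧ (lookup∘tabulate (λ i → lookup S (combine i j)) i)) ⟨
    sum {m} (⟦_⟧ ∘ lookup (slice j))           ≡⟨ ∣∣-sum (slice j) ⟨
    ∣ slice j ∣                                ≤⟨ α-maximum G (slice j) (slice-independent j) ⟩
    α G                                        ∎

^□-nonZero : ∀ G .{{_ : NonZero (order G)}} k → NonZero (order (G ^□ suc k))
^□-nonZero G zero    = >-nonZero (>-nonZero⁻¹ (order G))
^□-nonZero G (suc k) = m*n≢0 (order (G ^□ suc k)) (order G) {{^□-nonZero G k}}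

-- The m-th term is ratio (G ^□ (m + 1)).
ratios : (G : Graph) → .{{NonZero (order G)}} → ℕ → ℚᵘ
ratios G m = ratio (G ^□ suc m) {{^□-nonZero G m}}

ratios-mono : ∀ G .{{_ : NonZero (order G)}} m → ratios G (suc m) ℚ.≤ ratios G m
ratios-mono G m = frac-≤ (order (G ^□ suc m)) (order G)
  {{^□-nonZero G m}} {{it}} {{^□-nonZero G (suc m)}} (α-□ (G ^□ suc m) G)
  where
  frac-≤ : ∀ {a b} p q .{{_ : NonZero p}} .{{_ : NonZero q}} .{{_ : NonZero (p * q)}} →
           b ≤ q * a → ℤ.+ b ℚ./ (p * q) ℚ.≤ ℤ.+ a ℚ./ p
  frac-≤ {a} {b} p@(suc _) q@(suc _) b≤qa = ℚ.*≤* $ subst₂ ℤ._≤_ (ℤ.pos-* b p) (ℤ.pos-* a (p * q))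
    (ℤ.+≤+ (begin
      b * p         ≤⟨ *-monoˡ-≤ p b≤qa ⟩
      q * a * p     ≡⟨ cong (_* p) (*-comm q a) ⟩
      a * q * p     ≡⟨ *-assoc a q p ⟩
      a * (q * p)   ≡⟨ cong (a *_) (*-comm q p) ⟩
      a * (p * q)   ∎))
    where open ≤-Reasoning

ratios-nonNeg : ∀ G .{{_ : NonZero (order G)}} m → 0ℚᵘ ℚ.≤ ratios G m
ratios-nonNeg G m = frac-nonNeg (order (G ^□ suc m)) {{^□-nonZero G m}}
  where
  frac-nonNeg : ∀ {a} p .{{_ : NonZero p}} → 0ℚᵘ ℚ.≤ ℤ.+ a ℚ./ p
  frac-nonNeg {zero}  (suc _) = ℚ.nonNegative⁻¹ _
  frac-nonNeg {suc _} (suc _) = ℚ.nonNegative⁻¹ _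

-- The double negation makes this the classical Cauchy property: bounded
-- monotone sequences need not have a computable modulus of convergence.
Cauchy : (ℕ → ℚᵘ) → Set
Cauchy a = ∀ ε → .{{Positive ε}} →
  ¬ ¬ (∃ λ N → ∀ m n → m ≥ N → n ≥ N → ℚ.∣ a m ℚ.- a n ∣ ℚ.≤ ε)

-- A Cauchy sequence of rationals represents its own limit.
record ℝ : Set where
  constructor lim
  field
    seq    : ℕ → ℚᵘ
    cauchy : Cauchy seq

-- Classically this is the usual order; the witness N is asked for outright.
infix 4 _≤ℝ_

_≤ℝ_ : ℝ → ℝ → Set
x ≤ℝ y = ∀ ε → .{{Positive ε}} →
  ∃ λ N → ∀ n → n ≥ N → ℝ.seq x n ℚ.≤ ℝ.seq y n ℚ.+ ε

fromℚ : ℚᵘ → ℝ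
fromℚ q = lim (λ _ → q) λ ε ¬c → ¬c (0 , λ _ _ _ _ → begin
  ℚ.∣ q ℚ.- q ∣ ≃⟨ ℚ.∣-∣-cong (ℚ.+-inverseʳ q) ⟩
  0ℚᵘ           ≤⟨ ℚ.nonNegative⁻¹ ε {{ℚ.pos⇒nonNeg ε}} ⟩
  ε             ∎)
  where open ℚ.≤-Reasoning

private
  open import Algebra.Properties.AbelianGroup ℚ.+-0-abelianGroup using (xyx⁻¹≈y; ⁻¹-anti-homo‿-)
  open ℚ.≤-Reasoning

  x≤y+ε⇒x-y≤ε : ∀ {x y ε} → x ℚ.≤ y ℚ.+ ε → x ℚ.- y ℚ.≤ ε
  x≤y+ε⇒x-y≤ε {x} {y} {ε} x≤y+ε = begin
    x ℚ.- y          ≤⟨ ℚ.+-monoˡ-≤ (ℚ.- y) x≤y+ε ⟩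
    y ℚ.+ ε ℚ.- y    ≃⟨ xyx⁻¹≈y y ε ⟩
    ε                ∎

  close : ∀ x y {ε} → x ℚ.≤ y ℚ.+ ε → y ℚ.≤ x ℚ.+ ε → ℚ.∣ x ℚ.- y ∣ ℚ.≤ ε
  close x y {ε} x≤ y≤ with ℚ.∣p∣≡p∨∣p∣≡-p (x ℚ.- y)
  ... | inj₁ eq rewrite eq = x≤y+ε⇒x-y≤ε x≤
  ... | inj₂ eq rewrite eq = begin
    ℚ.- (x ℚ.- y)  ≃⟨ ⁻¹-anti-homo‿- x y ⟩
    y ℚ.- x        ≤⟨ x≤y+ε⇒x-y≤ε y≤ ⟩
    ε              ∎

  infixr 8 _·_

  _·_ : ℕ → ℚᵘ → ℚᵘ
  k · ε = mkℚᵘ (ℤ.+ k) 0 ℚ.* ε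

  suc-· : ∀ k ε → suc k · ε ℚ.≃ k · ε ℚ.+ ε
  suc-· k ε = begin-equality
    suc k · ε                            ≃⟨ ℚ.*-congʳ {ε} {mkℚᵘ (ℤ.+ suc k) 0} {mkℚᵘ (ℤ.+ k) 0 ℚ.+ ℚ.1ℚᵘ} (ℚ.*≡* (cong (ℤ._* ℤ.+ 1) (+-suc-ℤ k))) ⟩
    (mkℚᵘ (ℤ.+ k) 0 ℚ.+ ℚ.1ℚᵘ) ℚ.* ε     ≃⟨ ℚ.*-distribʳ-+ ε (mkℚᵘ (ℤ.+ k) 0) ℚ.1ℚᵘ ⟩
    k · ε ℚ.+ ℚ.1ℚᵘ ℚ.* ε                ≃⟨ ℚ.+-congʳ (k · ε) (ℚ.*-identityˡ ε) ⟩
    k · ε ℚ.+ ε                          ∎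
    where
    +-suc-ℤ : ∀ k → ℤ.+ suc k ≡ ℤ.+ k ℤ.* ℤ.+ 1 ℤ.+ ℤ.+ 1
    +-suc-ℤ k = trans (cong ℤ.+_ (sym (+-comm k 1))) (cong (ℤ._+ ℤ.+ 1) (sym (ℤ.*-identityʳ (ℤ.+ k))))

  archimedean : ∀ a ε → .{{Positive ε}} → ∃ λ k → a ℚ.< k · ε
  archimedean a@(mkℚᵘ n d) ε@(mkℚᵘ (ℤ.+[1+ p ]) q) = K , ℚ.*<* (ℤR.begin-strict
    n ℤ.* ℤ.+ Q                         ℤR.≤⟨ ℤ.*-monoʳ-≤-nonNeg (ℤ.+ Q) (n≤∣n∣ n) ⟩
    ℤ.+ ℤ.∣ n ∣ ℤ.* ℤ.+ Q               ℤR.≡⟨ ℤ.pos-* ℤ.∣ n ∣ Q ⟨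
    ℤ.+ (ℤ.∣ n ∣ * Q)                   ℤR.<⟨ ℤ.+<+ (≤-<-trans (≤-reflexive (cong (λ z → ℤ.∣ n ∣ * suc z) (+-identityʳ q)))
                                                    (<-≤-trans (m<n+m _ z<s) (≤-trans (m≤m*n K (suc p)) (m≤m*n _ (suc d))))) ⟩
    ℤ.+ (K * suc p * suc d)             ℤR.≡⟨ ℤ.pos-* (K * suc p) (suc d) ⟩
    ℤ.+ (K * suc p) ℤ.* ℤ.+ suc d       ℤR.≡⟨ cong (ℤ._* ℤ.+ suc d) (ℤ.pos-* K (suc p)) ⟩
    ℤ.+ K ℤ.* ℤ.+ suc p ℤ.* ℤ.+ suc d   ℤR.∎)
    where
    module ℤR = ℤ.≤-Reasoning
    K = suc ℤ.∣ n ∣ * suc q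
    Q = suc (q + 0)
    n≤∣n∣ : ∀ n → n ℤ.≤ ℤ.+ ℤ.∣ n ∣
    n≤∣n∣ (ℤ.+ n)      = ℤ.≤-refl
    n≤∣n∣ (ℤ.-[1+ n ]) = ℤ.-≤+

antitone⇒Cauchy : ∀ a → (∀ m → a (suc m) ℚ.≤ a m) → (∀ m → 0ℚᵘ ℚ.≤ a m) → Cauchy a
antitone⇒Cauchy a step a≥0 ε ¬cauchy with archimedean (a 0) ε
... | K , a₀<Kε = descend K λ (N , le) → ℚ.<⇒≱ a₀<Kε (begin
  K · ε               ≃⟨ ℚ.+-identityˡ (K · ε) ⟨
  0ℚᵘ ℚ.+ K · ε       ≤⟨ ℚ.+-monoˡ-≤ (K · ε) (a≥0 N) ⟩
  a N ℚ.+ K · ε       ≤⟨ le ⟩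
  a 0                 ∎)
  where
  antitone : ∀ {m n} → m ≤′ n → a n ℚ.≤ a m
  antitone ≤′-refl            = ℚ.≤-refl
  antitone (≤′-step {n} m≤n)  = ℚ.≤-trans (step n) (antitone m≤n)

  Drop : ℕ → Set
  Drop k = ∃ λ N → a N ℚ.+ k · ε ℚ.≤ a 0

  extend : ∀ k → Drop k → ¬ ¬ Drop (suc k)
  extend k (N , le) ¬drop = ¬cauchy (N , λ m n m≥N n≥N →
    close (a m) (a n) (ℚ.≤-trans (antitone (≤⇒≤′ m≥N)) (near n))
                      (ℚ.≤-trans (antitone (≤⇒≤′ n≥N)) (near m)))
    where
    near : ∀ m → a N ℚ.≤ a m ℚ.+ ε
    near m = ℚ.≮⇒≥ λ lt → ¬drop (m , (begin
      a m ℚ.+ suc k · ε           ≃⟨ ℚ.+-congʳ (a m) (ℚ.≃-trans (suc-· k ε) (ℚ.+-comm (k · ε) ε)) ⟩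
      a m ℚ.+ (ε ℚ.+ k · ε)       ≃⟨ ℚ.+-assoc (a m) ε (k · ε) ⟨
      a m ℚ.+ ε ℚ.+ k · ε         ≤⟨ ℚ.+-monoˡ-≤ (k · ε) (ℚ.<⇒≤ lt) ⟩
      a N ℚ.+ k · ε               ≤⟨ le ⟩
      a 0                         ∎))

  descend : ∀ k → ¬ ¬ Drop k
  descend zero    ¬drop = ¬drop (0 , ℚ.≤-reflexive
    (ℚ.≃-trans (ℚ.+-congʳ (a 0) (ℚ.*-zeroˡ ε)) (ℚ.+-identityʳ (a 0))))
  descend (suc k) ¬drop = descend k λ drop → extend k drop ¬drop

-- lim a c is the limit of a: for every ε > 0, |a m - lim a c| ≤ ε for large m.
lim-converges : ∀ a (c : Cauchy a) ε → .{{Positive ε}} → ¬ ¬ (∃ λ N → ∀ m → m ≥ N →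
  (fromℚ (a m ℚ.- ε) ≤ℝ lim a c) × (lim a c ≤ℝ fromℚ (a m ℚ.+ ε)))
lim-converges a c ε ¬lim = c ε λ (N , near) → ¬lim (N , λ m m≥N →
    (λ δ → N , λ n n≥N → ℚ.≤-trans (lower {a m} {a n} (near m n m≥N n≥N)) (ℚ.p≤p+q (a n) δ {{ℚ.pos⇒nonNeg δ}}))
  , (λ δ → N , λ n n≥N → ℚ.≤-trans (upper {a n} {a m} (near n m n≥N m≥N)) (ℚ.p≤p+q _ δ {{ℚ.pos⇒nonNeg δ}})))
  where
  p≤∣p∣ : ∀ p → p ℚ.≤ ℚ.∣ p ∣
  p≤∣p∣ p with ℚ.≤-total 0ℚᵘ p
  ... | inj₁ 0≤p = ℚ.≤-reflexive (ℚ.≃-sym (ℚ.0≤p⇒∣p∣≃p 0≤p))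
  ... | inj₂ p≤0 = ℚ.≤-trans p≤0 (ℚ.0≤∣p∣ p)

  cancel : ∀ x y → x ℚ.- y ℚ.+ y ℚ.≃ x
  cancel x y = ℚ.≃-trans (ℚ.+-assoc x (ℚ.- y) y)
    (ℚ.≃-trans (ℚ.+-congʳ x (ℚ.+-inverseˡ y)) (ℚ.+-identityʳ x))

  upper : ∀ {x y} → ℚ.∣ x ℚ.- y ∣ ℚ.≤ ε → x ℚ.≤ y ℚ.+ ε
  upper {x} {y} d = begin
    x                  ≃⟨ cancel x y ⟨
    x ℚ.- y ℚ.+ y      ≤⟨ ℚ.+-monoˡ-≤ y (ℚ.≤-trans (p≤∣p∣ _) d) ⟩
    ε ℚ.+ y            ≃⟨ ℚ.+-comm ε y ⟩
    y ℚ.+ ε            ∎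

  lower : ∀ {x y} → ℚ.∣ x ℚ.- y ∣ ℚ.≤ ε → x ℚ.- ε ℚ.≤ y
  lower {x} {y} d = x≤y+ε⇒x-y≤ε {x} {ε} {y} (ℚ.≤-trans (upper {x} {y} d) (ℚ.≤-reflexive (ℚ.+-comm y ε)))

𝓘 : (G : Graph) → .{{NonZero (order G)}} → ℝ
𝓘 G = lim (ratios G) (antitone⇒Cauchy (ratios G) (ratios-mono G) (ratios-nonNeg G))

{-# OPTIONS --safe #-}

-- Write n = 2t + 1 and N = n + 1, and let S be an independent set of
-- W n ^□ (m + 2). Over each vertex u of W n ^□ m it has a section, a set of f u
-- vertices of W n □ W n. On a triangle of W n ^□ m the three sections are
-- disjoint and independent, so they form a partial 3-colouring of W n □ W n.
-- The main point is that such a colouring leaves at least n + 3 vertices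
-- uncoloured ("deleted"); hence f sums to at most N² − (n + 3) = 4t² + 6t over
-- every triangle. Summing over all triangles of W n ^□ m counts a vertex with a
-- multiplicity that depends only on its number of hub coordinates, which is
-- close to its mean m / N at most vertices. So the mean of f is at most
-- (4t² + 6t) / 3 + o(1).
--
-- To bound the number of deletions, call the copies {x} □ W n rows and the
-- copies W n □ {y} columns. Each contains a deletion, being an odd wheel. A
-- parity argument along the rim shows that a row whose hub has colour a has a
-- deletion in one of a bounded number of columns that depend only on a and the
-- hub row: those near the deletions of the hub row, or those around a rim vertex
-- of the hub row that has colour a and two neighbours of different colours. Since
-- the columns elsewhere need deletions of their own, there are about 2n
-- deletions. This suffices except for n = 7, 9 and 11, where an exhaustive
-- search rules out the remaining cases.

module Submission where

open import Defs
open import Data.Bool.Base using (Bool; true; false; _∧_; _∨_; _xor_; not; if_then_else_)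
open import Data.Bool.Properties as Bool using (not-involutive; not-¬; ¬-not; xor-same)
open import Data.Empty using (⊥; ⊥-elim)
open import Data.Fin.Base as Fin using (Fin; toℕ; combine; _↑ˡ_; _↑ʳ_)
open import Data.Fin.Properties using (remQuot-combine; toℕ-fromℕ<; toℕ-injective; toℕ<n)
open import Data.Fin.Subset using (Subset; ∣_∣)
open import Data.Integer.Base as ℤ using (+[1+_])
import Data.Integer.Properties as ℤ
open import Data.List.Base using (List; []; _∷_; _++_; applyUpTo; length; map; replicate)
open import Data.List.Properties using (length-++; map-applyUpTo)
open import Data.List.Relation.Unary.Any using (Any; here; there)
open import Data.List.Relation.Unary.Any.Properties using (++⁺ˡ; ++⁺ʳ; applyUpTo⁺)
open import Data.Nat.Base as ℕ hiding (_/_)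
open import Data.Nat.DivMod
  using (_mod_; m≡m%n+[m/n]*n; m%n<n; m<n⇒m%n≡m; m%n%n≡m%n; n%n≡0; [m+n]%n≡m%n; %-distribˡ-+)
open import Data.Nat.Properties
open import Data.Nat.Tactic.RingSolver using (solve-∀)
open import Data.Product.Base using (_×_; _,_; proj₁; proj₂; ∃)
open import Data.Rational.Unnormalised.Base as ℚ using (mkℚᵘ; _/_)
import Data.Rational.Unnormalised.Properties as ℚ
open import Data.Sum.Base using (_⊎_; inj₁; inj₂; [_,_]′)
open import Data.Unit.Base using (tt)
open import Data.Vec.Base using ([]; _∷_; lookup)
open import Data.Vec.Properties using (lookup⇒[]=)
open import Function.Base using (_∘_; id)
open import Function.Bundles using (Inverse)
open import Relation.Binary.PropositionalEquality
open import Relation.Nullary using (Dec; yes; no; ¬_; contradiction)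

open import Algebra.Properties.CommutativeMonoid.Sum +-0-commutativeMonoid using (sum; ∑-comm; ∑-distrib-+; sum-cong-≗)
open import Algebra.Properties.Semiring.Sum +-*-semiring using (*-distribˡ-sum)

open Graph using (V; Adj; order; vertex)

-- Sums and periodic sequences

∑ : ℕ → (ℕ → ℕ) → ℕ
∑ n f = sum {n} (f ∘ toℕ)

∑-cong : ∀ n {f g : ℕ → ℕ} → (∀ i → f i ≡ g i) → ∑ n f ≡ ∑ n g
∑-cong n f≗g = sum-cong-≗ {n} (f≗g ∘ toℕ)

∑-+ : ∀ n f g → ∑ n (λ i → f i + g i) ≡ ∑ n f + ∑ n g
∑-+ n f g = ∑-distrib-+ {n} (f ∘ toℕ) (g ∘ toℕ)

∑-* : ∀ n c f → ∑ n (λ i → c * f i) ≡ c * ∑ n f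
∑-* n c f = sym (*-distribˡ-sum {n} c (f ∘ toℕ))

∑-swap : ∀ m n (f : ℕ → ℕ → ℕ) → ∑ m (λ i → ∑ n (f i)) ≡ ∑ n (λ j → ∑ m λ i → f i j)
∑-swap m n f = ∑-comm {m} {n} (λ i j → f (toℕ i) (toℕ j))

∑-mono : ∀ n {f g : ℕ → ℕ} → (∀ i → i < n → f i ≤ g i) → ∑ n f ≤ ∑ n g
∑-mono zero    f≤g = z≤n
∑-mono (suc n) f≤g = +-mono-≤ (f≤g 0 z<s) (∑-mono n λ i i<n → f≤g (suc i) (s<s i<n))

∑-const : ∀ n c → ∑ n (λ _ → c) ≡ n * c
∑-const zero    c = refl
∑-const (suc n) c = cong (c +_) (∑-const n c)

term≤∑ : ∀ {n} f {i} → i < n → f i ≤ ∑ n f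
term≤∑ f {zero}  z<s       = m≤m+n (f 0) _
term≤∑ f {suc i} (s<s i<n) = ≤-trans (term≤∑ (f ∘ suc) i<n) (m≤n+m _ (f 0))

∑-last : ∀ n f → ∑ (suc n) f ≡ ∑ n f + f n
∑-last zero    f = +-comm (f 0) 0
∑-last (suc n) f = trans (cong (f 0 +_) (∑-last n (f ∘ suc))) (sym (+-assoc (f 0) _ _))

∑-pred : ∀ n f → (∀ i → 1 ≤ f i) → ∑ n (pred ∘ f) + n ≡ ∑ n f
∑-pred zero    f 1≤f = refl
∑-pred (suc n) f 1≤f = begin
  pred (f 0) + ∑ n (pred ∘ f ∘ suc) + suc n      ≡⟨ lemma (pred (f 0)) _ n ⟩
  suc (pred (f 0)) + (∑ n (pred ∘ f ∘ suc) + n)  ≡⟨ cong₂ _+_ (suc-pred (f 0) {{>-nonZero (1≤f 0)}}) (∑-pred n (f ∘ suc) (1≤f ∘ suc)) ⟩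
  f 0 + ∑ n (f ∘ suc)                            ∎
  where
  open ≡-Reasoning
  lemma : ∀ a b c → a + b + suc c ≡ suc a + (b + c)
  lemma = solve-∀

-- Cyclic positions are represented by all natural numbers, read through an `n`-periodic function,
-- so that a step along a rim is `suc` even where the rim closes.
Periodic : {A : Set} → ℕ → (ℕ → A) → Set
Periodic n f = ∀ j → f (n + j) ≡ f j

module _ {A : Set} {n : ℕ} {f : ℕ → A} (f-per : Periodic n f) where

  periodic-* : ∀ q j → f (q * n + j) ≡ f j
  periodic-* zero    j = refl
  periodic-* (suc q) j = trans (cong f (+-assoc n (q * n) j)) (trans (f-per (q * n + j)) (periodic-* q j))

  periodic-+ : ∀ c j → f (c + (n + j)) ≡ f (c + j)
  periodic-+ c j = trans (cong f (trans (sym (+-assoc c n j)) (trans (cong (_+ j) (+-comm c n)) (+-assoc n c j)))) (f-per (c + j))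

  periodic-wrap : f n ≡ f 0
  periodic-wrap = trans (cong f (sym (+-identityʳ n))) (f-per 0)

  periodic-% : .{{_ : NonZero n}} → ∀ j → f (j % n) ≡ f j
  periodic-% j = sym (trans (cong f (trans (m≡m%n+[m/n]*n j n) (+-comm (j % n) _))) (periodic-* (j ℕ./ n) (j % n)))

shift-periodic : {A : Set} {n : ℕ} {f : ℕ → A} → Periodic n f → ∀ p → Periodic n (λ j → f (j + p))
shift-periodic {n = n} {f} f-per p j = trans (cong f (+-assoc n j p)) (f-per (j + p))

∑-shift : ∀ n {f} → Periodic n f → ∀ p → ∑ n (λ j → f (j + p)) ≡ ∑ n f
∑-shift n {f} f-per zero    = ∑-cong n λ j → cong f (+-identityʳ j)
∑-shift n {f} f-per (suc p) = trans (∑-cong n λ j → cong f (+-suc j p))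
  (trans (shift₁ (shift-periodic f-per p)) (∑-shift n f-per p))
  where
  shift₁ : ∀ {g} → Periodic n g → ∑ n (g ∘ suc) ≡ ∑ n g
  shift₁ {g} g-per = +-cancelˡ-≡ (g 0) _ _ (begin
    g 0 + ∑ n (g ∘ suc)  ≡⟨ ∑-last n g ⟩
    ∑ n g + g n          ≡⟨ cong (∑ n g +_) (periodic-wrap g-per) ⟩
    ∑ n g + g 0          ≡⟨ +-comm (∑ n g) (g 0) ⟩
    g 0 + ∑ n g          ∎)
    where open ≡-Reasoning

term≤∑-periodic : ∀ n .{{_ : NonZero n}} {f} → Periodic n f → ∀ j → f j ≤ ∑ n f
term≤∑-periodic n {f} f-per j = subst (_≤ ∑ n f) (periodic-% f-per j) (term≤∑ f (m%n<n j n))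

-- If no two consecutive values agreed, `s` would alternate, and after the odd number `t + t + 1` of
-- steps it would have the value `not (s 0)`. This is the parity argument behind both `wheel` and
-- `side-deletion`.
odd-cycle : ∀ t (s : ℕ → Bool) → s (suc (t + t)) ≡ s 0 → ∃ λ j → s (suc j) ≡ s j
odd-cycle t s wrap = [ id , (λ eq → contradiction (trans (sym wrap) (trans eq (cong not (even t (s 0))))) (not-¬ refl)) ]′
  (alternates (suc (t + t)))
  where
  nots : ℕ → Bool → Bool
  nots zero    b = b
  nots (suc m) b = not (nots m b)

  even : ∀ t b → nots (t + t) b ≡ b
  even zero    b = refl
  even (suc t) b rewrite +-suc t t = trans (not-involutive _) (even t b)

  alternates : ∀ m → (∃ λ j → s (suc j) ≡ s j) ⊎ s m ≡ nots m (s 0)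
  alternates zero = inj₂ refl
  alternates (suc m) with alternates m
  ... | inj₁ found = inj₁ found
  ... | inj₂ eq with s (suc m) Bool.≟ s m
  ...   | yes same = inj₁ (m , same)
  ...   | no  diff = inj₂ (trans (¬-not diff) (cong not eq))

-- Exhaustive search for partial colourings

data Cell : Set where
  red green blue none : Cell

allCells : (Cell → Bool) → Bool
allCells P = P red ∧ P green ∧ P blue ∧ P none

allCells-sound : ∀ P → allCells P ≡ true → ∀ v → P v ≡ true
allCells-sound P t v with P red in r | P green in g | P blue in b | P none in n
allCells-sound P t red   | true | _    | _    | _    = r
allCells-sound P t green | true | true | _    | _    = g
allCells-sound P t blue  | true | true | true | _    = b
allCells-sound P t none  | true | true | true | true = n

clash : Cell → Cell → Bool
clash red   red   = true
clash green green = true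
clash blue  blue  = true
clash _     _     = false

infix 4 _⟂_

_⟂_ : Cell → Cell → Set
u ⟂ v = clash u v ≡ false

⟂-sym : ∀ {u v} → u ⟂ v → v ⟂ u
⟂-sym {red}   {green} _ = refl
⟂-sym {red}   {blue}  _ = refl
⟂-sym {red}   {none}  _ = refl
⟂-sym {green} {red}   _ = refl
⟂-sym {green} {blue}  _ = refl
⟂-sym {green} {none}  _ = refl
⟂-sym {blue}  {red}   _ = refl
⟂-sym {blue}  {green} _ = refl
⟂-sym {blue}  {none}  _ = refl
⟂-sym {none}  {red}   _ = refl
⟂-sym {none}  {green} _ = refl
⟂-sym {none}  {blue}  _ = refl
⟂-sym {none}  {none}  _ = refl

⟂-none : ∀ v → v ⟂ none
⟂-none red   = refl
⟂-none green = refl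
⟂-none blue  = refl
⟂-none none  = refl

deleted : Cell → Bool
deleted none = true
deleted _    = false

δ : Cell → ℕ
δ none = 1
δ _    = 0

-- The part of a column seen so far: its cell in the hub row, its cell in the
-- previous row, and whether it already contains a deleted cell.
record Column : Set where
  constructor col
  field
    top  : Cell
    last : Cell
    hit  : Bool
open Column

place : Cell → Column → Column
place v (col k u d) = col k v (deleted v ∨ d)

-- a and x are the numbers of deletions still allowed in the current row and
-- of deletions still allowed in columns that are already hit.
remove : (d : Bool) (a x : ℕ) → (ℕ → ℕ → Bool) → Bool
remove _     zero    _       K = true
remove false (suc a) x       K = K a x
remove true  (suc a) zero    K = true
remove true  (suc a) (suc x) K = K a x

-- The answer `true` means refuted: a budget is exhausted, the cell clashes with the hub-row cell
-- `k`, the cell above `u`, the row hub `h` or the cell to the left `l`, or the continuation `K`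
-- refutes every completion.
try : Column → (h l : Cell) (a x : ℕ) → (Column → ℕ → ℕ → Bool) → Cell → Bool
try (col k u d) h l a x K none = remove d a x (K (col k none true))
try (col k u d) h l a x K v    = clash v k ∨ clash v u ∨ clash v h ∨ clash v l ∨ K (col k v d) a x

branch : Column → (h l : Cell) (a x : ℕ) → (Column → ℕ → ℕ → Bool) → Bool
branch c h l a x K = allCells (try c h l a x K)

scan : List Column → (h l : Cell) (a x : ℕ) → (List Column → Cell → ℕ → ℕ → Bool) → Bool
scan []       h l a x K = K [] l a x
scan (c ∷ cs) h l a x K = branch c h l a x λ c′ a′ x′ →
  scan cs h (last c′) a′ x′ λ cs′ → K (c′ ∷ cs′)

clashes : List Cell → List Column → Bool
clashes (v ∷ vs) (c ∷ cs) = clash v (last c) ∨ clashes vs cs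
clashes _        _        = false

clashFirst : Cell → List Cell → Bool
clashFirst l []      = false
clashFirst l (v ∷ _) = clash l v

-- The allowance is `suc e` because every row is granted one deletion on top of the common excess;
-- what remains after the row is the excess for the later rows. The hub cell of the row is placed
-- first, in the hub column `c`.
row : Column → List Column → (e x : ℕ) → (Column → List Column → ℕ → ℕ → Bool) → Bool
row c cs e x K = branch c none none (suc e) x λ c′ a x →
  scan cs (last c′) none a x λ cs′ l a x → clashFirst l (map last cs′) ∨ K c′ cs′ a x

rows : ℕ → Cell → List Cell → Column → List Column → (e x : ℕ) → Bool
-- All rim rows are placed; the rim of each column closes up against the first rim row `f ∷ fs`.
rows zero    f fs c cs e x = clash f (last c) ∨ clashes fs cs
rows (suc m) f fs c cs e x = row c cs e x (rows m f fs)

cyclicRows : ℕ → Column → List Column → (e x : ℕ) → Bool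
cyclicRows zero    c cs e x = false
cyclicRows (suc m) c cs e x = row c cs e x λ c′ cs′ → rows m (last c′) (map last cs′) c′ cs′

-- The previous cell is `none`, which clashes with nothing: the first rim row is compared with its
-- cyclic predecessor only at the end.
headed : Cell → Column
headed v = col v none (deleted v)

lastOf : Cell → List Cell → Cell
lastOf v []       = v
lastOf _ (v ∷ vs) = lastOf v vs

-- True only if W n □ W n has no partial colouring whose hub row has hub z and
-- rim cells starting with pre, followed by m cells with at most o deletions,
-- such that the rim rows contain at most e deletions in excess of one each, and
-- the columns at most one.
refutes : (m : ℕ) (z : Cell) (pre : List Cell) (o e : ℕ) → ℕ → Bool
refutes m z pre o e n = scan (replicate m (col none none false)) z (lastOf none pre) o 0 λ cs l _ _ →
  let ks = pre ++ map last cs in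
  clashFirst l ks ∨ cyclicRows n (headed z) (map headed ks) e 1

-- A type former, unlike refutes, is compared without running the search.
data Refuted (m : ℕ) (z : Cell) (pre : List Cell) (o e n : ℕ) : Set where
  by-search : refutes m z pre o e n ≡ true → Refuted m z pre o e n

∨-falseˡ : ∀ {a b} → a ≡ false → a ∨ b ≡ true → b ≡ true
∨-falseˡ refl b = b

cost : Bool → Cell → ℕ
cost true  v = δ v
cost false v = 0

-- The soundness lemmas follow one actual colouring through the search: if every choice is refuted,
-- so is the choice `v` that the colouring makes. Each budget is a cost plus a remainder, so that
-- paying for `v` leaves exactly `a` and `x`.
branch-sound : ∀ {k u h l a x} d v K → v ⟂ k → v ⟂ u → v ⟂ h → v ⟂ l →
  branch (col k u d) h l (δ v + a) (cost d v + x) K ≡ true → K (place v (col k u d)) a x ≡ true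
branch-sound {k} {u} {h} {l} {a} {x} d v K vk vu vh vl t =
  place-sound d v vk vu vh vl (allCells-sound (try (col k u d) h l (δ v + a) (cost d v + x) K) t v)
  where
  place-sound : ∀ d v → v ⟂ k → v ⟂ u → v ⟂ h → v ⟂ l →
    try (col k u d) h l (δ v + a) (cost d v + x) K v ≡ true → K (place v (col k u d)) a x ≡ true
  place-sound true  none  _ _ _ _ t = t
  place-sound false none  _ _ _ _ t = t
  place-sound true  red   vk vu vh vl t = ∨-falseˡ vl (∨-falseˡ vh (∨-falseˡ vu (∨-falseˡ vk t)))
  place-sound false red   vk vu vh vl t = ∨-falseˡ vl (∨-falseˡ vh (∨-falseˡ vu (∨-falseˡ vk t)))
  place-sound true  green vk vu vh vl t = ∨-falseˡ vl (∨-falseˡ vh (∨-falseˡ vu (∨-falseˡ vk t)))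
  place-sound false green vk vu vh vl t = ∨-falseˡ vl (∨-falseˡ vh (∨-falseˡ vu (∨-falseˡ vk t)))
  place-sound true  blue  vk vu vh vl t = ∨-falseˡ vl (∨-falseˡ vh (∨-falseˡ vu (∨-falseˡ vk t)))
  place-sound false blue  vk vu vh vl t = ∨-falseˡ vl (∨-falseˡ vh (∨-falseˡ vu (∨-falseˡ vk t)))

lastFrom : Cell → (ℕ → Cell) → ℕ → Cell
lastFrom l v zero    = l
lastFrom l v (suc m) = lastFrom (v 0) (v ∘ suc) m

lastFrom-suc : ∀ l v m → lastFrom l v (suc m) ≡ v m
lastFrom-suc l v zero    = refl
lastFrom-suc l v (suc m) = lastFrom-suc (v 0) (v ∘ suc) m

scan-sound : ∀ m {h l a x} (c : ℕ → Column) (v : ℕ → Cell) K →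
  (∀ j → v j ⟂ top (c j)) → (∀ j → v j ⟂ last (c j)) → (∀ j → v j ⟂ h) →
  v 0 ⟂ l → (∀ j → v (suc j) ⟂ v j) →
  scan (applyUpTo c m) h l (∑ m (δ ∘ v) + a) (∑ m (λ j → cost (hit (c j)) (v j)) + x) K ≡ true →
  K (applyUpTo (λ j → place (v j) (c j)) m) (lastFrom l v m) a x ≡ true
scan-sound zero c v K vk vu vh vl vv t = t
scan-sound (suc m) {h} {l} {a} {x} c v K vk vu vh vl vv t
  rewrite +-assoc (δ (v 0)) (∑ m (δ ∘ v ∘ suc)) a
        | +-assoc (cost (hit (c 0)) (v 0)) (∑ m (λ j → cost (hit (c (suc j))) (v (suc j)))) x
  = scan-sound m (c ∘ suc) (v ∘ suc) (λ cs′ → K (place (v 0) (c 0) ∷ cs′))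
      (vk ∘ suc) (vu ∘ suc) (vh ∘ suc) (vv 0) (vv ∘ suc)
      (branch-sound (hit (c 0)) (v 0)
        (λ c′ a′ x′ → scan (applyUpTo (c ∘ suc) m) h (last c′) a′ x′ λ cs′ → K (c′ ∷ cs′))
        (vk 0) (vu 0) (vh 0) vl t)

clashFirst-periodic : ∀ n l w → (∀ j → w (suc j) ⟂ w j) → Periodic n w →
  ∀ (c : ℕ → Column) → (∀ j → last (c j) ≡ w j) →
  clashFirst (lastFrom l w n) (map last (applyUpTo c n)) ≡ false
clashFirst-periodic zero    l w ww per c eq = refl
clashFirst-periodic (suc n) l w ww per c eq = subst₂ _⟂_ (sym (lastFrom-suc l w n)) (sym (eq 0))
  (⟂-sym (subst (_⟂ w n) (trans (cong (w ∘ suc) (sym (+-identityʳ n))) (per 0)) (ww n)))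

-- Of `f` deletions still to come in a column, the number charged to the column budget: all of them
-- if the column is already hit, otherwise all but the first.
pending : Bool → ℕ → ℕ
pending true  f = f
pending false f = pred f

pending-step : ∀ d v f → pending d (δ v + f) ≡ cost d v + pending (deleted v ∨ d) f
pending-step true  red   f = refl
pending-step true  green f = refl
pending-step true  blue  f = refl
pending-step true  none  f = refl
pending-step false red   f = refl
pending-step false green f = refl
pending-step false blue  f = refl
pending-step false none  f = refl

module _ (n : ℕ) (z : Cell) (k : ℕ → Cell) where

  Proper : Cell → (ℕ → Cell) → Set
  Proper g w = g ⟂ z × (∀ j → w j ⟂ k j) × (∀ j → w j ⟂ g) × (∀ j → w (suc j) ⟂ w j) × Periodic n w

  weight : Cell → (ℕ → Cell) → ℕ
  weight g w = δ g + ∑ n (δ ∘ w)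

  columns : (ℕ → Cell) → (ℕ → Bool) → List Column
  columns u d = applyUpTo (λ j → col (k j) (u j) (d j)) n

  -- Here `f₀` and `f j` count the deletions of the columns in the rows still to come. By
  -- `pending-step` the column budget before the row is the cost of this row plus the budget of the
  -- same form after it.
  row-sound : ∀ {u₀ u e x} d₀ d g w (f₀ : ℕ) (f : ℕ → ℕ) K → 1 ≤ weight g w →
    g ⟂ u₀ → (∀ j → w j ⟂ u j) → Proper g w →
    row (col z u₀ d₀) (columns u d) (pred (weight g w) + e)
        (pending d₀ (δ g + f₀) + ∑ n (λ j → pending (d j) (δ (w j) + f j)) + x) K ≡ true →
    K (col z g (deleted g ∨ d₀)) (columns w (λ j → deleted (w j) ∨ d j)) e
      (pending (deleted g ∨ d₀) f₀ + ∑ n (λ j → pending (deleted (w j) ∨ d j) (f j)) + x) ≡ true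
  row-sound {u₀} {u} {e} {x} d₀ d g w f₀ f K 1≤r gu wu (gz , wk , wg , ww , per) t =
    ∨-falseˡ wrap
      (scan-sound n (λ j → col (k j) (u j) (d j)) w
        (λ cs′ l a x → clashFirst l (map last cs′) ∨ K (col z g (deleted g ∨ d₀)) cs′ a x)
        wk wu wg (⟂-none _) ww
        (branch-sound d₀ g
          (λ c′ a x → scan (columns u d) (last c′) none a x λ cs′ l a x →
            clashFirst l (map last cs′) ∨ K c′ cs′ a x)
          gz gu (⟂-none _) (⟂-none _)
          (subst₂ (λ a b → row′ a b ≡ true) allowance budget t)))
    where
    row′ : ℕ → ℕ → Bool
    row′ a b = branch (col z u₀ d₀) none none a b λ c′ a x →
      scan (columns u d) (last c′) none a x λ cs′ l a x → clashFirst l (map last cs′) ∨ K c′ cs′ a x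
    rest  = pending (deleted g ∨ d₀) f₀
    restⱼ = ∑ n (λ j → pending (deleted (w j) ∨ d j) (f j))
    costⱼ = ∑ n (λ j → cost (d j) (w j))
    allowance : suc (pred (weight g w) + e) ≡ δ g + (∑ n (δ ∘ w) + e)
    allowance = trans (cong (_+ e) (suc-pred (weight g w) {{>-nonZero 1≤r}})) (+-assoc (δ g) _ e)
    regroup : ∀ a b c d x → a + b + (c + d) + x ≡ a + (c + (b + d + x))
    regroup = solve-∀
    budget : pending d₀ (δ g + f₀) + ∑ n (λ j → pending (d j) (δ (w j) + f j)) + x
           ≡ cost d₀ g + (costⱼ + (rest + restⱼ + x))
    budget = trans (cong (_+ x) (cong₂ _+_ (pending-step d₀ g f₀)
        (trans (∑-cong n λ j → pending-step (d j) (w j) (f j))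
               (∑-+ n (λ j → cost (d j) (w j)) (λ j → pending (deleted (w j) ∨ d j) (f j))))))
      (regroup (cost d₀ g) rest costⱼ restⱼ x)
    wrap : clashFirst (lastFrom none w n) (map last (columns w (λ j → deleted (w j) ∨ d j))) ≡ false
    wrap = clashFirst-periodic n none w ww per (λ j → col (k j) (w j) (deleted (w j) ∨ d j)) (λ _ → refl)

  -- Row 0 is already placed. After the other `m` rows only the closing comparison remains, where a
  -- genuine colouring has no clash, so the search cannot have answered `true`.
  rows-sound : ∀ m (h : ℕ → Cell) (M : ℕ → ℕ → Cell) f F d₀ d {e x} →
    (∀ i → Proper (h i) (M i)) → (∀ i → h (suc i) ⟂ h i) → (∀ i j → M (suc i) j ⟂ M i j) →
    (∀ i → 1 ≤ weight (h i) (M i)) → f ⟂ h m → (∀ j → F j ⟂ M m j) →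
    rows m f (applyUpTo F n) (col z (h 0) d₀) (columns (M 0) d)
      (∑ m (λ i → pred (weight (h (suc i)) (M (suc i)))) + e)
      (pending d₀ (∑ m (δ ∘ h ∘ suc)) + ∑ n (λ j → pending (d j) (∑ m λ i → δ (M (suc i) j))) + x) ≢ true
  rows-sound zero h M f F d₀ d proper hh MM 1≤r fh FM t
    = contradiction (trans (sym t) (cong₂ _∨_ fh (noClashes n F (λ j → col (k j) (M 0 j) (d j)) FM))) λ ()
    where
    noClashes : ∀ n F c → (∀ j → F j ⟂ last (c j)) → clashes (applyUpTo F n) (applyUpTo c n) ≡ false
    noClashes zero    F c FM = refl
    noClashes (suc n) F c FM = cong₂ _∨_ (FM 0) (noClashes n (F ∘ suc) (c ∘ suc) (FM ∘ suc))
  rows-sound (suc m) h M f F d₀ d {e} {x} proper hh MM 1≤r fh FM t =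
    rows-sound m (h ∘ suc) (M ∘ suc) f F _ (λ j → deleted (M 1 j) ∨ d j)
      (proper ∘ suc) (hh ∘ suc) (MM ∘ suc) (1≤r ∘ suc) fh FM
      (row-sound d₀ d (h 1) (M 1) (∑ m (δ ∘ h ∘ suc ∘ suc)) (λ j → ∑ m λ i → δ (M (suc (suc i)) j)) (rows m f (applyUpTo F n)) (1≤r 1) (hh 0) (MM 0) (proper 1)
        (subst (λ e → rows (suc m) f (applyUpTo F n) (col z (h 0) d₀) (columns (M 0) d) e X ≡ true)
          (+-assoc (pred (weight (h 1) (M 1))) _ e) t))
    where
    X = pending d₀ (∑ (suc m) (δ ∘ h ∘ suc)) + ∑ n (λ j → pending (d j) (∑ (suc m) λ i → δ (M (suc i) j))) + x

  cyclicRows-sound : ∀ m (h : ℕ → Cell) (M : ℕ → ℕ → Cell) {e x} →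
    (∀ i → Proper (h i) (M i)) → (∀ i → h (suc i) ⟂ h i) → (∀ i j → M (suc i) j ⟂ M i j) →
    (∀ i → 1 ≤ weight (h i) (M i)) → h 0 ⟂ h m → (∀ j → M 0 j ⟂ M m j) →
    cyclicRows (suc m) (headed z) (applyUpTo (headed ∘ k) n)
      (∑ (suc m) (λ i → pred (weight (h i) (M i))) + e)
      (pending (deleted z) (∑ (suc m) (δ ∘ h)) +
       ∑ n (λ j → pending (deleted (k j)) (∑ (suc m) λ i → δ (M i j))) + x) ≢ true
  cyclicRows-sound m h M {e} {x} proper hh MM 1≤r wrap Wrap t =
    rows-sound m h M (h 0) (M 0) (deleted (h 0) ∨ deleted z) (λ j → deleted (M 0 j) ∨ deleted (k j)) {e} {x}
      proper hh MM 1≤r wrap Wrap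
      (subst (λ fs → rows m (h 0) fs (col z (h 0) (deleted (h 0) ∨ deleted z)) (columns (M 0) _) (E + e) (X + x) ≡ true)
        (map-applyUpTo (λ j → col (k j) (M 0 j) (deleted (M 0 j) ∨ deleted (k j))) last n)
      (row-sound (deleted z) (deleted ∘ k) (h 0) (M 0) (∑ m (δ ∘ h ∘ suc)) (λ j → ∑ m λ i → δ (M (suc i) j))
        (λ c′ cs′ → rows m (last c′) (map last cs′) c′ cs′)
        (1≤r 0) (⟂-none _) (λ _ → ⟂-none _) (proper 0)
        (subst (λ e → row (headed z) (applyUpTo (headed ∘ k) n) e X₀ (λ c′ cs′ → rows m (last c′) (map last cs′) c′ cs′) ≡ true)
          (+-assoc (pred (weight (h 0) (M 0))) E e) t)))
    where
    E = ∑ m (λ i → pred (weight (h (suc i)) (M (suc i))))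
    X = pending (deleted (h 0) ∨ deleted z) (∑ m (δ ∘ h ∘ suc))
      + ∑ n (λ j → pending (deleted (M 0 j) ∨ deleted (k j)) (∑ m λ i → δ (M (suc i) j)))
    X₀ = pending (deleted z) (∑ (suc m) (δ ∘ h)) +
      ∑ n (λ j → pending (deleted (k j)) (∑ (suc m) λ i → δ (M i j))) + x

applyUpTo-++ : ∀ {A : Set} (f : ℕ → A) p m → applyUpTo f p ++ applyUpTo (λ j → f (p + j)) m ≡ applyUpTo f (p + m)
applyUpTo-++ f zero    m = refl
applyUpTo-++ f (suc p) m = cong (f 0 ∷_) (applyUpTo-++ (f ∘ suc) p m)

replicate-applyUpTo : ∀ {A : Set} m (a : A) → replicate m a ≡ applyUpTo (λ _ → a) m
replicate-applyUpTo zero    a = refl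
replicate-applyUpTo (suc m) a = cong (a ∷_) (replicate-applyUpTo m a)

lastOf-applyUpTo : ∀ v k p → lastOf v (applyUpTo k p) ≡ lastFrom v k p
lastOf-applyUpTo v k zero    = refl
lastOf-applyUpTo v k (suc p) = lastOf-applyUpTo (k 0) (k ∘ suc) p

lastFrom-+ : ∀ v k p m → lastFrom (lastFrom v k p) (λ j → k (p + j)) m ≡ lastFrom v k (p + m)
lastFrom-+ v k zero    m = refl
lastFrom-+ v k (suc p) m = lastFrom-+ (k 0) (k ∘ suc) p m

refutes-sound : ∀ p m {n} → p + m ≡ suc n → ∀ z k (h : ℕ → Cell) (M : ℕ → ℕ → Cell) {o e} →
  (∀ j → k j ⟂ z) → (∀ j → k (suc j) ⟂ k j) → Periodic (suc n) k →
  ∑ m (λ j → δ (k (p + j))) ≤ o →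
  (∀ i → Proper (suc n) z k (h i) (M i)) → (∀ i → h (suc i) ⟂ h i) → (∀ i j → M (suc i) j ⟂ M i j) →
  (∀ i → 1 ≤ weight (suc n) z k (h i) (M i)) → h 0 ⟂ h n → (∀ j → M 0 j ⟂ M n j) →
  ∑ (suc n) (λ i → pred (weight (suc n) z k (h i) (M i))) ≤ e →
  pending (deleted z) (∑ (suc n) (δ ∘ h)) +
    ∑ (suc n) (λ j → pending (deleted (k j)) (∑ (suc n) λ i → δ (M i j))) ≤ 1 →
  ¬ Refuted m z (applyUpTo k p) o e (suc n)
refutes-sound p m {n} p+m z k h M {o} {e} kz kk per holes proper hh MM 1≤r wrap Wrap E≤e X≤1 (by-search t) =
  cyclicRows-sound (suc n) z k n h M proper hh MM 1≤r wrap Wrap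
    (subst₂ (λ e x → cyclicRows (suc n) (headed z) (applyUpTo (headed ∘ k) (suc n)) e x ≡ true)
      -- The search is started with the full bounds `e` and 1; what the colouring does not use
      -- becomes the remainder in each budget.
      (sym (m+[n∸m]≡n E≤e)) (sym (m+[n∸m]≡n X≤1))
      (subst (λ cs → cyclicRows (suc n) (headed z) cs e 1 ≡ true)
        (trans (cong (map headed) ks≡) (map-applyUpTo k headed (suc n)))
        (∨-falseˡ noWrapClash scanned)))
  where
  finish : List Column → Cell → ℕ → ℕ → Bool
  finish cs l _ _ = clashFirst l (applyUpTo k p ++ map last cs)
                  ∨ cyclicRows (suc n) (headed z) (map headed (applyUpTo k p ++ map last cs)) e 1

  c₀ : Column
  c₀ = col none none false

  placed : List Column
  placed = applyUpTo (λ j → place (k (p + j)) c₀) m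

  kl : ∀ p → k (p + 0) ⟂ lastFrom none k p
  kl zero    = ⟂-none _
  kl (suc p) = subst₂ _⟂_ (cong (k ∘ suc) (sym (+-identityʳ p))) (sym (lastFrom-suc none k p)) (kk p)

  scanned : finish placed (lastFrom (lastFrom none k p) (λ j → k (p + j)) m) (o ∸ ∑ m (λ j → δ (k (p + j)))) 0 ≡ true
  scanned = scan-sound m (λ _ → c₀) (λ j → k (p + j)) finish
    (λ _ → ⟂-none _) (λ _ → ⟂-none _) (λ j → kz (p + j)) (kl p)
    (λ j → subst (λ i → k i ⟂ k (p + j)) (sym (+-suc p j)) (kk (p + j)))
    (subst₂ (λ o x → scan (applyUpTo (λ _ → c₀) m) z (lastFrom none k p) o x finish ≡ true)
      -- While the hub row is laid out no column counts as hit, so the column budget 0 is enough.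
      (sym (m+[n∸m]≡n holes)) (sym (trans (+-identityʳ _) (trans (∑-const m 0) (*-zeroʳ m))))
    (subst₂ (λ cs l → scan cs z l o 0 finish ≡ true) (replicate-applyUpTo m c₀) (lastOf-applyUpTo none k p) t))

  ks≡ : applyUpTo k p ++ map last placed ≡ applyUpTo k (suc n)
  ks≡ = trans (cong (applyUpTo k p ++_) (map-applyUpTo (λ j → place (k (p + j)) c₀) last m))
    (trans (applyUpTo-++ k p m) (cong (applyUpTo k) p+m))

  noWrapClash : clashFirst (lastFrom (lastFrom none k p) (λ j → k (p + j)) m) (applyUpTo k p ++ map last placed) ≡ false
  noWrapClash = subst₂ (λ l ks → clashFirst l ks ≡ false)
    (sym (trans (lastFrom-+ none k p m) (cong (lastFrom none k) p+m))) (sym ks≡)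
    (subst (λ ks → clashFirst (lastFrom none k (suc n)) ks ≡ false) (map-applyUpTo (λ j → col none (k j) false) last (suc n))
      (clashFirst-periodic (suc n) none k kk per (λ j → col none (k j) false) (λ _ → refl)))

-- Local colour constraints in a wheel and between two rows

next : Cell → Cell
next red   = green
next green = blue
next blue  = red
next none  = none

∨-true : ∀ a {b} → a ∨ b ≡ true → a ≡ true ⊎ b ≡ true
∨-true true  _ = inj₁ refl
∨-true false b = inj₂ b

xor-≡ : ∀ {a b} → a ≡ b → b xor a ≡ false
xor-≡ {a} refl = xor-same a

deleted⇒none : ∀ v → deleted v ≡ true → v ≡ none
deleted⇒none none _ = refl

none⇒1≤δ : ∀ {v} → v ≡ none → 1 ≤ δ v
none⇒1≤δ refl = ≤-refl

-- If all three cells are coloured, `u` and `v` have the two colours other than that of `g`, so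
-- exactly one of them is `next g`. The finitely many cases are evaluated.
wheel-local : ∀ g u v → u ⟂ g → v ⟂ g → v ⟂ u → clash (next g) v ≡ clash (next g) u →
  (g ≡ none ⊎ u ≡ none) ⊎ v ≡ none
wheel-local g u v ug vg vu same =
  [ inj₁ ∘ [ inj₁ ∘ deleted⇒none g , inj₂ ∘ deleted⇒none u ]′ ∘ ∨-true (deleted g) , inj₂ ∘ deleted⇒none v ]′
  (∨-true (deleted g ∨ deleted u)
    (∨-falseˡ (xor-≡ same) (∨-falseˡ vu (∨-falseˡ vg (∨-falseˡ ug
      (allCells-sound (formula g u) (allCells-sound (λ u → allCells (formula g u)) (allCells-sound (λ g → allCells λ u → allCells (formula g u)) refl g) u) v))))))
  where
  formula : Cell → Cell → Cell → Bool
  formula g u v = clash u g ∨ clash v g ∨ clash v u ∨ (clash (next g) u xor clash (next g) v)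
    ∨ (deleted g ∨ deleted u) ∨ deleted v

-- An odd wheel is not 3-colourable: without a deletion, the cells of colour `next g` would
-- alternate along the odd rim.
wheel : ∀ t g w → (∀ j → w j ⟂ g) → (∀ j → w (suc j) ⟂ w j) → Periodic (suc (t + t)) w →
  1 ≤ δ g + ∑ (suc (t + t)) (δ ∘ w)
wheel t g w wg ww per with odd-cycle t (λ j → clash (next g) (w j)) (cong (clash (next g)) (trans (cong w (sym (+-identityʳ _))) (per 0)))
... | j , same with wheel-local g (w j) (w (suc j)) (wg j) (wg (suc j)) (ww j) same
...   | inj₁ (inj₁ g≡) = ≤-trans (none⇒1≤δ g≡) (m≤m+n (δ g) _)
...   | inj₁ (inj₂ u≡) = ≤-trans (none⇒1≤δ u≡) (≤-trans (term≤∑-periodic _ (cong δ ∘ per) j) (m≤n+m _ (δ g)))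
...   | inj₂ v≡        = ≤-trans (none⇒1≤δ v≡) (≤-trans (term≤∑-periodic _ (cong δ ∘ per) (suc j)) (m≤n+m _ (δ g)))

-- u, v and w stand for consecutive rim cells of the hub row.
turns : Cell → (u v w : Cell) → Bool
turns a u v w = clash v a ∧ not (deleted u) ∧ not (deleted w) ∧ not (clash u w)

-- x is the cell below v in a row with hub a; away from deleted cells, v and
-- its neighbours determine whether x has colour next (next a).
side : Cell → (u v w x : Cell) → Bool
side a u v w x =
  if deleted u ∨ deleted v ∨ deleted w then clash (next (next a)) x else
  if clash v a then clash w (next (next a)) else clash v (next a)

module Exhaustive where
  ∀₂ : (Cell → Cell → Bool) → Bool
  ∀₂ P = allCells λ u → allCells (P u)

  ∀₃ : (Cell → Cell → Cell → Bool) → Bool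
  ∀₃ P = allCells λ u → ∀₂ (P u)

  ∀₃-sound : ∀ P → ∀₃ P ≡ true → ∀ u v w → P u v w ≡ true
  ∀₃-sound P t u v = allCells-sound (P u v) (allCells-sound (allCells ∘ P u) (allCells-sound (∀₂ ∘ P) t u) v)

  -- The first disjuncts are the failures of the hypotheses.
  turn-formula : (a u v w x y z : Cell) → Bool
  turn-formula a u v w x y z = deleted a ∨ clash v u ∨ clash w v ∨ clash x a ∨ clash y a ∨ clash z a ∨ clash x u ∨ clash z w
    ∨ clash y x ∨ clash z y ∨ not (turns a u v w) ∨ (deleted x ∨ deleted y) ∨ deleted z

  -- At a turn `u` and `w` have the two colours other than `a`. If `x` and `z` are coloured, `x` has
  -- the colour of `w` and `z` that of `u`; no colour is left for `y`, which is adjacent to both and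
  -- to the hub `a`.
  turn-check : ∀ a u v w x y z → turn-formula a u v w x y z ≡ true
  turn-check a u v w = ∀₃-sound (turn-formula a u v w) (∀₃-sound (λ u v w → ∀₃ (turn-formula a u v w)) (table a) u v w)
    where
    table : ∀ a → ∀₃ (λ u v w → ∀₃ (turn-formula a u v w)) ≡ true
    table red   = refl
    table green = refl
    table blue  = refl
    table none  = refl

  side-formula : (a k₀ k₁ k₂ k₃ x y : Cell) → Bool
  side-formula a k₀ k₁ k₂ k₃ x y = deleted a ∨ clash k₁ k₀ ∨ clash k₂ k₁ ∨ clash k₃ k₂ ∨ clash x a ∨ clash y a
    ∨ clash x k₁ ∨ clash y k₂ ∨ clash y x ∨ (side a k₀ k₁ k₂ x xor side a k₁ k₂ k₃ y)
    ∨ (turns a k₀ k₁ k₂ ∨ turns a k₁ k₂ k₃)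
    ∨ (deleted x ∨ deleted y) ∧ ((deleted k₀ ∨ deleted k₁) ∨ (deleted k₂ ∨ deleted k₃))

  -- Suppose that there is no turn. If the four hub-row cells are coloured, they determine both
  -- values of `side`, which differ. If `x` and `y` are coloured, `side` tells whether the cell has
  -- colour `next (next a)`, which is true of exactly one of them. Equal values therefore need a
  -- deletion in both rows.
  side-check : ∀ a k₀ k₁ k₂ k₃ x y → side-formula a k₀ k₁ k₂ k₃ x y ≡ true
  side-check a k₀ k₁ k₂ = ∀₃-sound (side-formula a k₀ k₁ k₂) (∀₃-sound (λ k₀ k₁ k₂ → ∀₃ (side-formula a k₀ k₁ k₂)) (table a) k₀ k₁ k₂)
    where
    table : ∀ a → ∀₃ (λ k₀ k₁ k₂ → ∀₃ (side-formula a k₀ k₁ k₂)) ≡ true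
    table red   = refl
    table green = refl
    table blue  = refl
    table none  = refl

  no-turn-formula : (z a u v w : Cell) → Bool
  no-turn-formula z a u v w = deleted z ∨ clash u z ∨ clash v z ∨ clash w z ∨ clash v u ∨ clash w v ∨ not (turns a u v w)

  -- A turn shows three different colours on the rim, and a coloured hub `z` adjacent to all three
  -- would need a fourth.
  no-turn-check : ∀ z a u v w → no-turn-formula z a u v w ≡ true
  no-turn-check z a = ∀₃-sound (no-turn-formula z a)
    (allCells-sound (λ a → ∀₃ (no-turn-formula z a)) (allCells-sound (λ z → allCells λ a → ∀₃ (no-turn-formula z a)) refl z) a)

open Exhaustive

-- Partial 3-colourings of W n □ W n

⟦_⟧ : Bool → ℕ
⟦ b ⟧ = if b then 1 else 0

≡ᵇ-refl : ∀ m → (m ≡ᵇ m) ≡ true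
≡ᵇ-refl zero    = refl
≡ᵇ-refl (suc m) = ≡ᵇ-refl m

-- A partial 3-colouring of W n □ W n for n = 2t + 1, with cells z at
-- (hub, hub), k j at (hub, j), h i at (i, hub) and M i j at (i, j).
record Grid (t : ℕ) : Set where
  field
    z   : Cell
    k h : ℕ → Cell
    M   : ℕ → ℕ → Cell
    kz  : ∀ j → k j ⟂ z
    hz  : ∀ i → h i ⟂ z
    kk  : ∀ j → k (suc j) ⟂ k j
    hh  : ∀ i → h (suc i) ⟂ h i
    Mk  : ∀ i j → M i j ⟂ k j
    Mh  : ∀ i j → M i j ⟂ h i
    Mʳ  : ∀ i j → M i (suc j) ⟂ M i j
    Mᶜ  : ∀ i j → M (suc i) j ⟂ M i j

  n : ℕ
  n = suc (t + t)

  field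
    k-periodic  : Periodic n k
    h-periodic  : Periodic n h
    Mʳ-periodic : ∀ i → Periodic n (M i)
    Mᶜ-periodic : ∀ j → Periodic n (λ i → M i j)

  hubRow : ℕ
  hubRow = δ z + ∑ n (δ ∘ k)

  rimRow : ℕ → ℕ
  rimRow i = δ (h i) + ∑ n (δ ∘ M i)

  rimColumn : ℕ → ℕ
  rimColumn j = δ (k j) + ∑ n (λ i → δ (M i j))

  total : ℕ
  total = hubRow + ∑ n rimRow

  1≤hubRow : 1 ≤ hubRow
  1≤hubRow = wheel t z k kz kk k-periodic

  1≤rimRow : ∀ i → 1 ≤ rimRow i
  1≤rimRow i = wheel t (h i) (M i) (Mh i) (Mʳ i) (Mʳ-periodic i)

  1≤rimColumn : ∀ j → 1 ≤ rimColumn j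
  1≤rimColumn j = wheel t (k j) (λ i → M i j) (λ i → Mk i j) (λ i → Mᶜ i j) (Mᶜ-periodic j)

  total-by-columns : total ≡ δ z + ∑ n (δ ∘ h) + ∑ n rimColumn
  total-by-columns = begin
    δ z + ∑ n (δ ∘ k) + ∑ n rimRow
      ≡⟨ cong (hubRow +_) (∑-+ n (δ ∘ h) (λ i → ∑ n (δ ∘ M i))) ⟩
    δ z + ∑ n (δ ∘ k) + (∑ n (δ ∘ h) + ∑ n (λ i → ∑ n (δ ∘ M i)))
      ≡⟨ swap (δ z) (∑ n (δ ∘ k)) (∑ n (δ ∘ h)) _ ⟩
    δ z + ∑ n (δ ∘ h) + (∑ n (δ ∘ k) + ∑ n (λ i → ∑ n (δ ∘ M i)))
      ≡⟨ cong (λ s → δ z + ∑ n (δ ∘ h) + (∑ n (δ ∘ k) + s)) (∑-swap n n (λ i j → δ (M i j))) ⟩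
    δ z + ∑ n (δ ∘ h) + (∑ n (δ ∘ k) + ∑ n (λ j → ∑ n (λ i → δ (M i j))))
      ≡⟨ cong (δ z + ∑ n (δ ∘ h) +_) (∑-+ n (δ ∘ k) (λ j → ∑ n (λ i → δ (M i j)))) ⟨
    δ z + ∑ n (δ ∘ h) + ∑ n rimColumn ∎
    where
    open ≡-Reasoning
    swap : ∀ a b c d → a + b + (c + d) ≡ a + c + (b + d)
    swap = solve-∀

  hubRow+n≤total : hubRow + n ≤ total
  hubRow+n≤total = +-monoʳ-≤ hubRow (≤-trans (≤-reflexive (sym (trans (∑-const n 1) (*-identityʳ n))))
    (∑-mono n λ i _ → 1≤rimRow i))

  hits : List ℕ → ℕ → Bool
  hits []      j = false
  hits (x ∷ L) j = (x % n ≡ᵇ j) ∨ hits L j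

  hits-complete : ∀ {L j} → Any (λ x → x % n ≡ j) L → hits L j ≡ true
  hits-complete {x ∷ L} {j} (here refl) rewrite ≡ᵇ-refl (x % n) = refl
  hits-complete {x ∷ L} {j} (there x∈L) with x % n ≡ᵇ j
  ... | true  = refl
  ... | false = hits-complete x∈L

  ∑-hits : ∀ L → ∑ n (λ j → ⟦ hits L j ⟧) ≤ length L
  ∑-hits []      = ≤-reflexive (trans (∑-const n 0) (*-zeroʳ n))
  ∑-hits (x ∷ L) = begin
    ∑ n (λ j → ⟦ (x % n ≡ᵇ j) ∨ hits L j ⟧)                       ≤⟨ ∑-mono n (λ j _ → ⟦∨⟧ (x % n ≡ᵇ j) (hits L j)) ⟩
    ∑ n (λ j → ⟦ x % n ≡ᵇ j ⟧ + ⟦ hits L j ⟧)                     ≡⟨ ∑-+ n (λ j → ⟦ x % n ≡ᵇ j ⟧) (λ j → ⟦ hits L j ⟧) ⟩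
    ∑ n (λ j → ⟦ x % n ≡ᵇ j ⟧) + ∑ n (λ j → ⟦ hits L j ⟧)         ≤⟨ +-mono-≤ (∑-≡ᵇ n (x % n)) (∑-hits L) ⟩
    suc (length L)                                                ∎
    where
    open ≤-Reasoning
    ⟦∨⟧ : ∀ a b → ⟦ a ∨ b ⟧ ≤ ⟦ a ⟧ + ⟦ b ⟧
    ⟦∨⟧ true  b = s≤s z≤n
    ⟦∨⟧ false b = ≤-refl
    ∑-≡ᵇ : ∀ n c → ∑ n (λ j → ⟦ c ≡ᵇ j ⟧) ≤ 1
    ∑-≡ᵇ zero    c       = z≤n
    ∑-≡ᵇ (suc n) zero    = ≤-reflexive (cong suc (trans (∑-const n 0) (*-zeroʳ n)))
    ∑-≡ᵇ (suc n) (suc c) = ∑-≡ᵇ n c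

  -- Each row needs a deletion in the columns of L, and each column outside L
  -- needs one more.
  covering : ∀ L → (∀ i → h i ≡ none ⊎ Any (λ x → M i x ≡ none) L) →
    (∀ j → j < n → k j ≡ none → Any (λ x → x % n ≡ j) L) →
    hubRow + (n + n) ≤ total + length L
  covering L rows∈ holes∈ = begin
    hubRow + (n + n)                                         ≤⟨ +-monoʳ-≤ hubRow (+-mono-≤ (count inRow) (count inColumn)) ⟩
    hubRow + (∑ n (λ i → δ (h i) + ∑ n (inside i)) + ∑ n (λ j → ⟦ w j ⟧ + ∑ n (λ i → outside i j)))
      ≡⟨ cong (hubRow +_) (cong₂ _+_ (∑-+ n (δ ∘ h) (λ i → ∑ n (inside i))) (∑-+ n (λ j → ⟦ w j ⟧) (λ j → ∑ n (λ i → outside i j)))) ⟩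
    hubRow + (∑ n (δ ∘ h) + ∑ n (λ i → ∑ n (inside i)) + (∑ n (λ j → ⟦ w j ⟧) + ∑ n (λ j → ∑ n (λ i → outside i j))))
      ≡⟨ cong (λ s → hubRow + (∑ n (δ ∘ h) + ∑ n (λ i → ∑ n (inside i)) + (∑ n (λ j → ⟦ w j ⟧) + s))) (∑-swap n n outside) ⟨
    hubRow + (∑ n (δ ∘ h) + ∑ n (λ i → ∑ n (inside i)) + (∑ n (λ j → ⟦ w j ⟧) + ∑ n (λ i → ∑ n (outside i))))
      ≡⟨ regroup hubRow (∑ n (δ ∘ h)) (∑ n (λ i → ∑ n (inside i))) (∑ n (λ j → ⟦ w j ⟧)) (∑ n (λ i → ∑ n (outside i))) ⟩
    hubRow + (∑ n (δ ∘ h) + (∑ n (λ i → ∑ n (inside i)) + ∑ n (λ i → ∑ n (outside i)))) + ∑ n (λ j → ⟦ w j ⟧)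
      ≡⟨ cong (λ s → hubRow + (∑ n (δ ∘ h) + s) + ∑ n (λ j → ⟦ w j ⟧)) split ⟩
    hubRow + (∑ n (δ ∘ h) + ∑ n (λ i → ∑ n (δ ∘ M i))) + ∑ n (λ j → ⟦ w j ⟧)
      ≡⟨ cong (λ s → hubRow + s + ∑ n (λ j → ⟦ w j ⟧)) (∑-+ n (δ ∘ h) (λ i → ∑ n (δ ∘ M i))) ⟨
    total + ∑ n (λ j → ⟦ w j ⟧)                              ≤⟨ +-monoʳ-≤ total (∑-hits L) ⟩
    total + length L                                         ∎
    where
    open ≤-Reasoning
    w : ℕ → Bool
    w = hits L

    inside outside : ℕ → ℕ → ℕ
    inside  i j = if w j then δ (M i j) else 0
    outside i j = if w j then 0 else δ (M i j)

    regroup : ∀ a b c d e → a + (b + c + (d + e)) ≡ a + (b + (c + e)) + d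
    regroup = solve-∀

    split : ∑ n (λ i → ∑ n (inside i)) + ∑ n (λ i → ∑ n (outside i)) ≡ ∑ n (λ i → ∑ n (δ ∘ M i))
    split = trans (sym (∑-+ n (λ i → ∑ n (inside i)) (λ i → ∑ n (outside i))))
      (∑-cong n λ i → trans (sym (∑-+ n (inside i) (outside i))) (∑-cong n (split-cell i)))
      where
      split-cell : ∀ i j → inside i j + outside i j ≡ δ (M i j)
      split-cell i j with w j
      ... | true  = +-identityʳ _
      ... | false = refl

    count : ∀ {f} → (∀ i → i < n → 1 ≤ f i) → n ≤ ∑ n f
    count 1≤f = ≤-trans (≤-reflexive (sym (trans (∑-const n 1) (*-identityʳ n)))) (∑-mono n 1≤f)

    located : ∀ {i L} → Any (λ x → M i x ≡ none) L → ∃ λ x → M i (x % n) ≡ none × Any (λ y → y % n ≡ x % n) L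
    located {i} (here {x} eq) = x , trans (periodic-% (Mʳ-periodic i) x) eq , here refl
    located (there x∈) with located x∈
    ... | x , eq , x∈L = x , eq , there x∈L

    inRow : ∀ i → i < n → 1 ≤ δ (h i) + ∑ n (inside i)
    inRow i _ with rows∈ i
    ... | inj₁ h≡none = ≤-trans (none⇒1≤δ h≡none) (m≤m+n (δ (h i)) _)
    ... | inj₂ x∈L with located x∈L
    ...   | x , Mx≡none , hit = ≤-trans (≤-trans here≥1 (term≤∑ (inside i) (m%n<n x n))) (m≤n+m _ (δ (h i)))
      where
      here≥1 : 1 ≤ inside i (x % n)
      here≥1 rewrite hits-complete {L} hit = none⇒1≤δ Mx≡none

    inColumn : ∀ j → j < n → 1 ≤ ⟦ w j ⟧ + ∑ n (λ i → outside i j)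
    inColumn j j<n with w j in eq | k j in kj≡ | 1≤rimColumn j
    ... | true  | _     | _  = s≤s z≤n
    ... | false | red   | le = le
    ... | false | green | le = le
    ... | false | blue  | le = le
    -- A deleted hub-row cell would supply the deletion of its column by itself; this case is
    -- excluded because `L` contains all such columns.
    ... | false | none  | _  = contradiction (trans (sym eq) (hits-complete (holes∈ j j<n kj≡))) λ ()

-- Short lists of columns that meet a deletion of every rim row

∧-true : ∀ {a b} → a ∧ b ≡ true → a ≡ true × b ≡ true
∧-true {true} b = refl , b

windows : (ℕ → List ℕ) → ℕ → List ℕ
windows W zero    = []
windows W (suc m) = W 0 ++ windows (W ∘ suc) m

length-windows : ∀ W m → length (windows W m) ≡ ∑ m (length ∘ W)
length-windows W zero    = refl
length-windows W (suc m) = trans (length-++ (W 0)) (cong (length (W 0) +_) (length-windows (W ∘ suc) m))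

windows⁺ : ∀ {P : ℕ → Set} W {m j} → j < m → Any P (W j) → Any P (windows W m)
windows⁺ W {suc m} {zero}  _         p = ++⁺ˡ p
windows⁺ W {suc m} {suc j} (s<s j<m) p = ++⁺ʳ (W 0) (windows⁺ (W ∘ suc) j<m p)

module _ {t} (G : Grid (suc t)) where
  open Grid G

  private
    n′ : ℕ
    n′ = t + suc t

  -- The columns at distance at most 2 from j, if (hub, j) is deleted; n = 2 + n′.
  near : ℕ → List ℕ
  near j = if deleted (k j) then applyUpTo (λ w → j + (w + n′)) 5 else []

  holes : ℕ
  holes = ∑ n (δ ∘ k)

  length-near : length (windows near n) ≡ 5 * holes
  length-near = trans (length-windows near n) (trans (∑-cong n five) (∑-* n 5 (δ ∘ k)))
    where
    five : ∀ j → length (near j) ≡ 5 * δ (k j)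
    five j with k j
    ... | red   = refl
    ... | green = refl
    ... | blue  = refl
    ... | none  = refl

  near-holes : ∀ j → j < n → k j ≡ none → Any (λ x → x % n ≡ j) (windows near n)
  near-holes j j<n kj≡ = windows⁺ near j<n at-j
    where
    at-j : Any (λ x → x % n ≡ j) (near j)
    at-j rewrite kj≡ = there (there (here (trans (cong (_% n) (+-comm j n)) (trans (n+j%n j) (m<n⇒m%n≡m j<n)))))
      where
      n+j%n : ∀ j → (n + j) % n ≡ j % n
      n+j%n j = trans (cong (_% n) (+-comm n j)) ([m+n]%n≡m%n j n)

  -- The window of the hole `u + j` starts two columns before it, so column `v + j` stands there at
  -- position `w = 2 + v - u`.
  near-deletion : ∀ {i} j u v {w} → k (u + j) ≡ none → M i (v + j) ≡ none → w < 5 → u + w ≡ 2 + v →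
    Any (λ x → M i x ≡ none) (windows near n)
  near-deletion {i} j u v {w} hole Mij≡ w<5 u+w = windows⁺ near (m%n<n (u + j) n) in-window
    where
    e : ℕ
    e = (u + j) % n
    regroup : ∀ a b c d → a + b + (c + d) ≡ (a + c) + (d + b)
    regroup = solve-∀
    M≡ : M i (e + (w + n′)) ≡ none
    M≡ = begin
      M i (e + (w + n′))      ≡⟨ periodic-% (shift-periodic (Mʳ-periodic i) (w + n′)) (u + j) ⟩
      M i (u + j + (w + n′))  ≡⟨ cong (M i) (regroup u j w n′) ⟩
      M i (u + w + (n′ + j))  ≡⟨ cong (λ s → M i (s + (n′ + j))) u+w ⟩
      M i (2 + v + (n′ + j))  ≡⟨ cong (λ s → M i (2 + s)) (trans (sym (+-assoc v n′ j)) (trans (cong (_+ j) (+-comm v n′)) (+-assoc n′ v j))) ⟩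
      M i (n + (v + j))       ≡⟨ Mʳ-periodic i (v + j) ⟩
      M i (v + j)             ≡⟨ Mij≡ ⟩
      none                    ∎
      where open ≡-Reasoning
    in-window : Any (λ x → M i x ≡ none) (near e)
    in-window rewrite periodic-% k-periodic (u + j) | hole = applyUpTo⁺ (λ w → e + (w + n′)) M≡ w<5

  turnsAt : Cell → ℕ → Bool
  turnsAt a j = turns a (k j) (k (1 + j)) (k (2 + j))

  Turning : Cell → Set
  Turning a = ∃ λ j → j < n × turnsAt a j ≡ true

  turning? : ∀ a → Dec (Turning a)
  turning? a = anyUpTo? (λ j → turnsAt a j Bool.≟ true) n

  turnsAt-periodic : ∀ a → Periodic n (turnsAt a)
  turnsAt-periodic a j rewrite k-periodic j | periodic-+ k-periodic 1 j | periodic-+ k-periodic 2 j = refl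

  no-turn : ∀ {a} → ¬ Turning a → ∀ j → turnsAt a j ≡ false
  no-turn {a} ¬turning j = trans (sym (periodic-% (turnsAt-periodic a) j))
    (¬-not λ turn → ¬turning (j % n , m%n<n j n , turn))

  turn-deletion : ∀ {a} j → turnsAt a j ≡ true → a ≢ none → ∀ i → h i ≡ a →
    (M i j ≡ none ⊎ M i (1 + j) ≡ none) ⊎ M i (2 + j) ≡ none
  turn-deletion {a} j turn a≢ i refl =
    [ inj₁ ∘ [ inj₁ ∘ deleted⇒none _ , inj₂ ∘ deleted⇒none _ ]′ ∘ ∨-true _ , inj₂ ∘ deleted⇒none _ ]′
    (∨-true (deleted (M i j) ∨ deleted (M i (1 + j)))
      (∨-falseˡ (cong not turn) (∨-falseˡ (Mʳ i (1 + j)) (∨-falseˡ (Mʳ i j) (∨-falseˡ (Mk i (2 + j)) (∨-falseˡ (Mk i j)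
        (∨-falseˡ (Mh i (2 + j)) (∨-falseˡ (Mh i (1 + j)) (∨-falseˡ (Mh i j)
          (∨-falseˡ (kk (1 + j)) (∨-falseˡ (kk j) (∨-falseˡ (¬-not (a≢ ∘ deleted⇒none (h i)))
          (Exhaustive.turn-check (h i) (k j) (k (1 + j)) (k (2 + j)) (M i j) (M i (1 + j)) (M i (2 + j)))))))))))))))

  -- By `odd-cycle` the values of `side` along the row agree at two consecutive positions. As `a`
  -- has no turn, `side-check` gives a deletion of the row together with a hole of the hub row close
  -- by.
  side-deletion : ∀ {a} → ¬ Turning a → a ≢ none → ∀ i → h i ≡ a → Any (λ x → M i x ≡ none) (windows near n)
  side-deletion {a} ¬turning a≢ i refl = locate (odd-cycle (suc t) s (periodic-wrap s-periodic))
    where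
    s : ℕ → Bool
    s j = side (h i) (k j) (k (1 + j)) (k (2 + j)) (M i (1 + j))

    s-periodic : Periodic n s
    s-periodic j rewrite k-periodic j | periodic-+ k-periodic 1 j | periodic-+ k-periodic 2 j
                       | periodic-+ (Mʳ-periodic i) 1 j = refl

    locate : (∃ λ j → s (suc j) ≡ s j) → Any (λ x → M i x ≡ none) (windows near n)
    locate (j , same) = [ fromTurn , fromHole ]′ (∨-true (turnsAt (h i) j ∨ turnsAt (h i) (suc j)) found)
      where
      found : (turnsAt (h i) j ∨ turnsAt (h i) (suc j)) ∨ (deleted (M i (1 + j)) ∨ deleted (M i (2 + j)))
        ∧ ((deleted (k j) ∨ deleted (k (1 + j))) ∨ (deleted (k (2 + j)) ∨ deleted (k (3 + j)))) ≡ true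
      found = ∨-falseˡ (xor-≡ same) (∨-falseˡ (Mʳ i (1 + j)) (∨-falseˡ (Mk i (2 + j)) (∨-falseˡ (Mk i (1 + j))
        (∨-falseˡ (Mh i (2 + j)) (∨-falseˡ (Mh i (1 + j)) (∨-falseˡ (kk (2 + j)) (∨-falseˡ (kk (1 + j)) (∨-falseˡ (kk j)
        (∨-falseˡ (¬-not (a≢ ∘ deleted⇒none (h i)))
        (Exhaustive.side-check (h i) (k j) (k (1 + j)) (k (2 + j)) (k (3 + j)) (M i (1 + j)) (M i (2 + j))))))))))))

      fromTurn : turnsAt (h i) j ∨ turnsAt (h i) (suc j) ≡ true → Any (λ x → M i x ≡ none) (windows near n)
      fromTurn turn with trans (sym turn) (cong₂ _∨_ (no-turn ¬turning j) (no-turn ¬turning (suc j)))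
      ... | ()

      fromHole : (deleted (M i (1 + j)) ∨ deleted (M i (2 + j)))
        ∧ ((deleted (k j) ∨ deleted (k (1 + j))) ∨ (deleted (k (2 + j)) ∨ deleted (k (3 + j)))) ≡ true →
        Any (λ x → M i x ≡ none) (windows near n)
      fromHole both with ∧-true both
      ... | x , y with missing x | hole y
        where
        missing : deleted (M i (1 + j)) ∨ deleted (M i (2 + j)) ≡ true → ∃ λ v → v ≤ 1 × M i (suc v + j) ≡ none
        missing = [ (λ d → 0 , z≤n , deleted⇒none _ d) , (λ d → 1 , ≤-refl , deleted⇒none _ d) ]′
          ∘ ∨-true (deleted (M i (1 + j)))
        hole : (deleted (k j) ∨ deleted (k (1 + j))) ∨ (deleted (k (2 + j)) ∨ deleted (k (3 + j))) ≡ true →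
          ∃ λ u → u ≤ 3 × k (u + j) ≡ none
        hole = [ [ (λ d → 0 , z≤n , deleted⇒none _ d) , (λ d → 1 , s≤s z≤n , deleted⇒none _ d) ]′
                   ∘ ∨-true (deleted (k j))
               , [ (λ d → 2 , s≤s (s≤s z≤n) , deleted⇒none _ d) , (λ d → 3 , ≤-refl , deleted⇒none _ d) ]′
                   ∘ ∨-true (deleted (k (2 + j))) ]′ ∘ ∨-true (deleted (k j) ∨ deleted (k (1 + j)))
      -- The deletion is in column 1 or 2 and the hole in one of the columns 0 to 3, relative to
      -- `j`; the window position `3 + v - u` is thus at most 4.
      ...   | v , v≤1 , M≡ | u , u≤3 , k≡ = near-deletion j u (suc v) k≡ M≡
        (s≤s (≤-trans (m∸n≤m (3 + v) u) (+-monoʳ-≤ 3 v≤1))) (m+[n∸m]≡n (≤-trans u≤3 (m≤m+n 3 v)))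

module _ {t} (G : Grid (suc t)) where
  open Grid G

  -- One turn per colour suffices: by `turn-deletion` all rows with hub `a` have a deletion in these
  -- same three columns.
  turnWindow : ∀ {a} → Dec (Turning G a) → List ℕ
  turnWindow (yes (j , _)) = j ∷ 1 + j ∷ 2 + j ∷ []
  turnWindow (no _)        = []

  turnWindows : List ℕ
  turnWindows = turnWindow (turning? G red) ++ turnWindow (turning? G green) ++ turnWindow (turning? G blue)

  length-turnWindow : ∀ {a} (d : Dec (Turning G a)) → length (turnWindow d) ≤ 3
  length-turnWindow (yes _) = ≤-refl
  length-turnWindow (no _)  = z≤n

  length-turnWindows : length turnWindows ≡ length (turnWindow (turning? G red)) +
    (length (turnWindow (turning? G green)) + length (turnWindow (turning? G blue)))
  length-turnWindows = trans (length-++ (turnWindow (turning? G red)))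
    (cong (length (turnWindow (turning? G red)) +_) (length-++ (turnWindow (turning? G green))))

  turnWindows≤9 : length turnWindows ≤ 9
  turnWindows≤9 = ≤-trans (≤-reflexive length-turnWindows) (+-mono-≤ (length-turnWindow (turning? G red))
    (+-mono-≤ (length-turnWindow (turning? G green)) (length-turnWindow (turning? G blue))))

  ∈-turnWindow : ∀ {a} (d : Dec (Turning G a)) → a ≢ none → ∀ i → h i ≡ a → Turning G a →
    Any (λ x → M i x ≡ none) (turnWindow d)
  ∈-turnWindow (no ¬turning)          a≢ i hi turning = contradiction turning ¬turning
  ∈-turnWindow (yes (j , _ , turn)) a≢ i hi _ with turn-deletion G j turn a≢ i hi
  ... | inj₁ (inj₁ eq) = here eq
  ... | inj₁ (inj₂ eq) = there (here eq)
  ... | inj₂ eq        = there (there (here eq))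

  ∈-turnWindows : ∀ a → a ≢ none → ∀ i → h i ≡ a → Turning G a → Any (λ x → M i x ≡ none) turnWindows
  ∈-turnWindows red   a≢ i hi turning = ++⁺ˡ (∈-turnWindow (turning? G red) a≢ i hi turning)
  ∈-turnWindows green a≢ i hi turning = ++⁺ʳ (turnWindow (turning? G red))
    (++⁺ˡ (∈-turnWindow (turning? G green) a≢ i hi turning))
  ∈-turnWindows blue  a≢ i hi turning = ++⁺ʳ (turnWindow (turning? G red))
    (++⁺ʳ (turnWindow (turning? G green)) (∈-turnWindow (turning? G blue) a≢ i hi turning))
  ∈-turnWindows none  a≢ i hi turning = contradiction refl a≢

  rows-covered : ∀ B → (∀ a → a ≢ none → ¬ Turning G a → ∀ i → h i ≡ a → Any (λ x → M i x ≡ none) B) →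
    ∀ i → h i ≡ none ⊎ Any (λ x → M i x ≡ none) (B ++ turnWindows)
  rows-covered B inB i with deleted (h i) in eq
  ... | true  = inj₁ (deleted⇒none (h i) eq)
  ... | false with turning? G (h i)
  ...   | yes turning = inj₂ (++⁺ʳ B (∈-turnWindows (h i) real i refl turning))
    where
    real : h i ≢ none
    real hi = contradiction (trans (sym eq) (cong deleted hi)) λ ()
  ...   | no ¬turning = inj₂ (++⁺ˡ (inB (h i) (λ hi → contradiction (trans (sym eq) (cong deleted hi)) λ ()) ¬turning i refl))

  -- Rows whose hub colour has a turn are caught by the turn windows, the other rows with a coloured
  -- hub by the five columns around each hole.
  near-bound : hubRow + (n + n) ≤ total + (5 * holes G + length turnWindows)
  near-bound = subst (λ l → hubRow + (n + n) ≤ total + l)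
    (trans (length-++ (windows (near G) n)) (cong (_+ length turnWindows) (length-near G)))
    (covering (windows (near G) n ++ turnWindows)
      (rows-covered (windows (near G) n) λ a a≢ ¬turning → side-deletion G ¬turning a≢)
      (λ j j<n kj → ++⁺ˡ (near-holes G j j<n kj)))

  self : ℕ → List ℕ
  self j = if deleted (k j) then j ∷ [] else []

  -- When every colour turns, the turn windows catch all rows with a coloured hub, so a hole
  -- contributes only its own column instead of five.
  turn-bound : (∀ a → a ≢ none → Turning G a) → hubRow + (n + n) ≤ total + (holes G + length turnWindows)
  turn-bound turning = subst (λ l → hubRow + (n + n) ≤ total + l)
    (trans (length-++ (windows self n)) (cong (_+ length turnWindows) (trans (length-windows self n) (∑-cong n one))))
    (covering (windows self n ++ turnWindows)
      (rows-covered (windows self n) λ a a≢ ¬turning → contradiction (turning a a≢) ¬turning)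
      (λ j j<n kj → ++⁺ˡ (windows⁺ self j<n (at-j j<n kj))))
    where
    one : ∀ j → length (self j) ≡ δ (k j)
    one j with k j
    ... | red   = refl
    ... | green = refl
    ... | blue  = refl
    ... | none  = refl
    at-j : ∀ {j} → j < n → k j ≡ none → Any (λ x → x % n ≡ j) (self j)
    at-j {j} j<n kj rewrite kj = here (m<n⇒m%n≡m j<n)

  real-hub : z ≢ none → length turnWindows ≡ 0
  real-hub z≢ = trans length-turnWindows
    (cong₂ _+_ (empty (turning? G red)) (cong₂ _+_ (empty (turning? G green)) (empty (turning? G blue))))
    where
    empty : ∀ {a} (d : Dec (Turning G a)) → length (turnWindow d) ≡ 0
    empty (no _) = refl
    empty {a} (yes (j , _ , turn)) = contradiction
      (trans (sym (cong not turn)) (∨-falseˡ (kk (1 + j)) (∨-falseˡ (kk j) (∨-falseˡ (kz (2 + j)) (∨-falseˡ (kz (1 + j))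
        (∨-falseˡ (kz j) (∨-falseˡ (¬-not (z≢ ∘ deleted⇒none z))
          (Exhaustive.no-turn-check z a (k j) (k (1 + j)) (k (2 + j)))))))))) λ ()

  turning-or-short : (∀ a → a ≢ none → Turning G a) ⊎ length turnWindows ≤ 6
  turning-or-short = subst (λ l → (∀ a → a ≢ none → Turning G a) ⊎ l ≤ 6) (sym length-turnWindows)
    (cases (turning? G red) (turning? G green) (turning? G blue))
    where
    cases : (r : Dec (Turning G red)) (g : Dec (Turning G green)) (b : Dec (Turning G blue)) →
      (∀ a → a ≢ none → Turning G a) ⊎ length (turnWindow r) + (length (turnWindow g) + length (turnWindow b)) ≤ 6
    cases (yes r) (yes g) (yes b) = inj₁ λ
      { red _ → r ; green _ → g ; blue _ → b ; none a≢ → contradiction refl a≢ }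
    cases (no _) g b = inj₂ (+-mono-≤ (length-turnWindow g) (length-turnWindow b))
    cases r (no _) b = inj₂ (+-mono-≤ (length-turnWindow r) (length-turnWindow b))
    cases r@(yes _) g@(yes _) (no _) = inj₂ ≤-refl

  hole-below-n : 1 ≤ holes G → ∃ λ p → k p ≡ none
  hole-below-n 1≤ = positive n k 1≤
    where
    positive : ∀ n (k : ℕ → Cell) → 1 ≤ ∑ n (δ ∘ k) → ∃ λ p → k p ≡ none
    positive (suc n) k 1≤ with k 0 in eq
    ... | none  = 0 , eq
    ... | red   with p , kp ← positive n (k ∘ suc) 1≤ = suc p , kp
    ... | green with p , kp ← positive n (k ∘ suc) 1≤ = suc p , kp
    ... | blue  with p , kp ← positive n (k ∘ suc) 1≤ = suc p , kp

  -- Both budgets come from `total ≤ 2 + n`. One deletion in each of the `n` rim rows leaves an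
  -- excess of at most `2 - hubRow`, hence at most `e`; one in each of the `n + 1` columns leaves an
  -- excess of at most 1.
  refuted : ∀ p m {o e} → p + m ≡ n → ∑ m (λ j → δ (k (p + j))) ≤ o → 2 ≤ hubRow + e → total ≤ 2 + n →
    ¬ Refuted m z (applyUpTo k p) o e n
  refuted p m {o} {e} p+m rest≤o hub≤ total≤ = refutes-sound p m p+m z k h M kz kk k-periodic rest≤o
    (λ i → hz i , Mk i , Mh i , Mʳ i , Mʳ-periodic i) hh Mᶜ 1≤rimRow
    (subst (_⟂ h (suc t + suc t)) (periodic-wrap h-periodic) (hh (suc t + suc t)))
    (λ j → subst (_⟂ M (suc t + suc t) j) (periodic-wrap (Mᶜ-periodic j)) (Mᶜ (suc t + suc t) j))
    rows≤ columns≤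
    where
    open ≤-Reasoning
    excess : ℕ
    excess = ∑ n (λ i → pred (rimRow i))

    rows≤ : excess ≤ e
    rows≤ = +-cancelˡ-≤ (hubRow + n) _ _ (begin
      hubRow + n + excess    ≡⟨ trans (+-assoc hubRow n excess) (cong (hubRow +_) (+-comm n excess)) ⟩
      hubRow + (excess + n)  ≡⟨ cong (hubRow +_) (∑-pred n rimRow 1≤rimRow) ⟩
      total                  ≤⟨ total≤ ⟩
      2 + n                  ≤⟨ +-monoˡ-≤ n hub≤ ⟩
      hubRow + e + n         ≡⟨ trans (+-assoc hubRow e n) (trans (cong (hubRow +_) (+-comm e n)) (sym (+-assoc hubRow n e))) ⟩
      hubRow + n + e         ∎)

    pending-pred : ∀ v f → pending (deleted v) f ≡ pred (δ v + f)
    pending-pred red   f = refl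
    pending-pred green f = refl
    pending-pred blue  f = refl
    pending-pred none  f = refl

    left : ℕ
    left = δ z + ∑ n (δ ∘ h)

    regroup : ∀ a b n → a + b + (1 + n) ≡ suc a + (b + n)
    regroup = solve-∀

    columns≤ : pending (deleted z) (∑ n (δ ∘ h)) + ∑ n (λ j → pending (deleted (k j)) (∑ n λ i → δ (M i j))) ≤ 1
    columns≤ = +-cancelʳ-≤ (1 + n) _ _ (begin
      pending (deleted z) (∑ n (δ ∘ h)) + ∑ n (λ j → pending (deleted (k j)) (∑ n λ i → δ (M i j))) + (1 + n)
        ≡⟨ cong (_+ (1 + n)) (cong₂ _+_ (pending-pred z (∑ n (δ ∘ h))) (∑-cong n λ j → pending-pred (k j) (∑ n λ i → δ (M i j)))) ⟩
      pred left + ∑ n (pred ∘ rimColumn) + (1 + n)    ≡⟨ regroup (pred left) (∑ n (pred ∘ rimColumn)) n ⟩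
      suc (pred left) + (∑ n (pred ∘ rimColumn) + n)  ≡⟨ cong₂ _+_ (suc-pred left {{>-nonZero (wheel (suc t) z h hz hh h-periodic)}})
                                                                  (∑-pred n rimColumn 1≤rimColumn) ⟩
      left + ∑ n rimColumn                            ≡⟨ total-by-columns ⟨
      total                                           ≤⟨ total≤ ⟩
      1 + (1 + n)                                     ∎)

-- Symmetries of partial colourings: permuting colours and rotating columns

recolouring : (u v c : Cell) → Cell
recolouring u v none = none
recolouring u v c = if clash c u then red else if clash c v then green else blue

-- For distinct colours `u` and `v`, `recolouring u v` is a permutation of the colours: `u` goes to
-- `red`, `v` to `green` and the third colour to `blue`.
recolouring-clash : ∀ {u v} → u ≢ none → v ≢ none → v ⟂ u → ∀ c d → clash (recolouring u v c) (recolouring u v d) ≡ clash c d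
recolouring-clash {u} {v} u≢ v≢ vu c d = xor-false (∨-falseˡ vu (∨-falseˡ (¬-not (v≢ ∘ deleted⇒none v)) (∨-falseˡ (¬-not (u≢ ∘ deleted⇒none u)) (check u v c d))))
  where
  formula : (u v c d : Cell) → Bool
  formula u v c d = deleted u ∨ deleted v ∨ clash v u ∨ not (clash (recolouring u v c) (recolouring u v d) xor clash c d)
  check : ∀ u v c d → formula u v c d ≡ true
  check u = Exhaustive.∀₃-sound (formula u) (allCells-sound (λ u → Exhaustive.∀₃ (formula u)) refl u)
  xor-false : ∀ {a b} → not (a xor b) ≡ true → a ≡ b
  xor-false {true}  {true}  _ = refl
  xor-false {false} {false} _ = refl

recolouring-δ : ∀ u v c → δ (recolouring u v c) ≡ δ c
recolouring-δ u v none  = refl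
recolouring-δ u v red   with clash red u | clash red v
... | true  | _     = refl
... | false | true  = refl
... | false | false = refl
recolouring-δ u v green with clash green u | clash green v
... | true  | _     = refl
... | false | true  = refl
... | false | false = refl
recolouring-δ u v blue  with clash blue u | clash blue v
... | true  | _     = refl
... | false | true  = refl
... | false | false = refl

recolouring-first : ∀ {u} v → u ≢ none → recolouring u v u ≡ red
recolouring-first {red}   v _  = refl
recolouring-first {green} v _  = refl
recolouring-first {blue}  v _  = refl
recolouring-first {none}  v u≢ = contradiction refl u≢

recolouring-second : ∀ {u v} → v ≢ none → v ⟂ u → recolouring u v v ≡ green
recolouring-second {v = none}  v≢ _  = contradiction refl v≢
recolouring-second {v = red}   v≢ vu rewrite vu = refl
recolouring-second {v = green} v≢ vu rewrite vu = refl
recolouring-second {v = blue}  v≢ vu rewrite vu = refl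

module _ {t} (G : Grid t) where
  open Grid G

  rotate : ℕ → Grid t
  rotate p = record
    { z = z ; k = λ j → k (j + p) ; h = h ; M = λ i j → M i (j + p)
    ; kz = λ j → kz (j + p) ; hz = hz ; kk = λ j → kk (j + p) ; hh = hh
    ; Mk = λ i j → Mk i (j + p) ; Mh = λ i j → Mh i (j + p) ; Mʳ = λ i j → Mʳ i (j + p) ; Mᶜ = λ i j → Mᶜ i (j + p)
    ; k-periodic = shift-periodic k-periodic p ; h-periodic = h-periodic
    ; Mʳ-periodic = λ i → shift-periodic (Mʳ-periodic i) p ; Mᶜ-periodic = λ j → Mᶜ-periodic (j + p) }

  rotate-holes : ∀ p → ∑ n (λ j → δ (k (j + p))) ≡ ∑ n (δ ∘ k)
  rotate-holes p = ∑-shift n (cong δ ∘ k-periodic) p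

  rotate-total : ∀ p → Grid.total (rotate p) ≡ total
  rotate-total p = cong₂ _+_ (cong (δ z +_) (rotate-holes p))
    (∑-cong n λ i → cong (δ (h i) +_) (∑-shift n (cong δ ∘ Mʳ-periodic i) p))

  recolour : (π : Cell → Cell) → (∀ c d → clash (π c) (π d) ≡ clash c d) → Grid t
  recolour π π-clash = record
    { z = π z ; k = π ∘ k ; h = π ∘ h ; M = λ i j → π (M i j)
    ; kz = λ j → keep (kz j) ; hz = λ i → keep (hz i) ; kk = λ j → keep (kk j) ; hh = λ i → keep (hh i)
    ; Mk = λ i j → keep (Mk i j) ; Mh = λ i j → keep (Mh i j) ; Mʳ = λ i j → keep (Mʳ i j) ; Mᶜ = λ i j → keep (Mᶜ i j)
    ; k-periodic = cong π ∘ k-periodic ; h-periodic = cong π ∘ h-periodic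
    ; Mʳ-periodic = λ i → cong π ∘ Mʳ-periodic i ; Mᶜ-periodic = λ j → cong π ∘ Mᶜ-periodic j }
    where
    keep : ∀ {c d} → c ⟂ d → π c ⟂ π d
    keep {c} {d} cd = trans (π-clash c d) cd

  recolour-total : ∀ π π-clash → (∀ c → δ (π c) ≡ δ c) → Grid.total (recolour π π-clash) ≡ total
  recolour-total π _ π-δ = cong₂ _+_ (cong₂ _+_ (π-δ z) (∑-cong n (π-δ ∘ k)))
    (∑-cong n λ i → cong₂ _+_ (π-δ (h i)) (∑-cong n λ j → π-δ (M i j)))

-- Small rims and the lower bound on deletions

δ≡0⇒real : ∀ {v} → δ v ≡ 0 → v ≢ none
δ≡0⇒real {none} ()
δ≡0⇒real {red}   _ ()
δ≡0⇒real {green} _ ()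
δ≡0⇒real {blue}  _ ()

next-real : ∀ {v} → v ≢ none → next v ≢ none
next-real {none}  v≢ _ = v≢ refl
next-real {red}   v≢ ()
next-real {green} v≢ ()
next-real {blue}  v≢ ()

next-⟂ : ∀ v → next v ⟂ v
next-⟂ red   = refl
next-⟂ green = refl
next-⟂ blue  = refl
next-⟂ none  = refl

module _ {t} (G : Grid (suc t)) where
  open Grid G

  -- The hub cell and the prefix enter through equations, so that a normalised colouring can be
  -- matched with the literal data of a search.
  refuted-as : ∀ {c pre} p m {o e} → z ≡ c → applyUpTo k p ≡ pre → p + m ≡ n →
    ∑ m (λ j → δ (k (p + j))) ≤ o → 2 ≤ hubRow + e → total ≤ 2 + n → ¬ Refuted m c pre o e n
  refuted-as p m refl refl = refuted G p m

  covered-size : ∀ {a b} → a + (n + n) ≤ total + b → total ≤ 2 + n → a + n ≤ 2 + b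
  covered-size {a} {b} bound total≤ = +-cancelʳ-≤ n _ _ (begin
    a + n + n      ≡⟨ +-assoc a n n ⟩
    a + (n + n)    ≤⟨ bound ⟩
    total + b      ≤⟨ +-monoˡ-≤ b total≤ ⟩
    2 + n + b      ≡⟨ trans (+-assoc 2 n b) (trans (cong (2 +_) (+-comm n b)) (sym (+-assoc 2 b n))) ⟩
    2 + b + n      ∎)
    where open ≤-Reasoning

-- The first colours are normalised to cut down the number of branches of the
-- search.
module _ {t} (G : Grid (3 + t)) (total≤ : Grid.total G ≤ 2 + Grid.n G) where
  open Grid G

  full-hub-row : z ≡ none → holes G ≡ 0 → ¬ Refuted (2 + t + (3 + t)) none (red ∷ green ∷ []) 0 1 n
  full-hub-row z≡ none≡0 = refuted-as G′ 2 _ (cong π z≡)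
    (cong₂ (λ u v → u ∷ v ∷ []) (recolouring-first (k 1) real₀) (recolouring-second real₁ (kk 0)))
    refl (≤-reflexive rest≡0) (+-monoˡ-≤ 1 (Grid.1≤hubRow G′)) (≤-trans (≤-reflexive (recolour-total G π π-clash (recolouring-δ (k 0) (k 1)))) total≤)
    where
    π = recolouring (k 0) (k 1)
    real₀ = δ≡0⇒real (m+n≡0⇒m≡0 (δ (k 0)) none≡0)
    rest₁ = m+n≡0⇒n≡0 (δ (k 0)) none≡0
    real₁ = δ≡0⇒real (m+n≡0⇒m≡0 (δ (k 1)) rest₁)
    π-clash = recolouring-clash real₀ real₁ (kk 0)
    G′ = recolour G π π-clash
    rest≡0 : ∑ (2 + t + (3 + t)) (λ j → δ (π (k (2 + j)))) ≡ 0
    rest≡0 = trans (∑-cong (2 + t + (3 + t)) λ j → recolouring-δ (k 0) (k 1) (k (2 + j))) (m+n≡0⇒n≡0 (δ (k 1)) rest₁)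

  one-hole : z ≡ none → k 0 ≡ none → holes G ≡ 1 → ¬ Refuted (1 + t + (3 + t)) none (none ∷ red ∷ green ∷ []) 0 0 n
  one-hole z≡ k₀ one = refuted-as G′ 3 _ (cong π z≡)
    (cong₂ _∷_ (cong π k₀) (cong₂ (λ u v → u ∷ v ∷ []) (recolouring-first (k 2) real₁) (recolouring-second real₂ (kk 1))))
    refl (≤-reflexive rest≡0)
    (≤-reflexive (sym (trans (+-identityʳ _) (cong₂ (λ z s → δ (π z) + s) z≡ (trans (∑-cong n (recolouring-δ (k 1) (k 2) ∘ k)) one)))))
    (≤-trans (≤-reflexive (recolour-total G π π-clash (recolouring-δ (k 1) (k 2)))) total≤)
    where
    rest₀ : ∑ (3 + t + (3 + t)) (δ ∘ k ∘ suc) ≡ 0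
    rest₀ = suc-injective (trans (cong (λ v → δ v + ∑ (3 + t + (3 + t)) (δ ∘ k ∘ suc)) (sym k₀)) one)
    real₁ = δ≡0⇒real (m+n≡0⇒m≡0 (δ (k 1)) rest₀)
    rest₁ = m+n≡0⇒n≡0 (δ (k 1)) rest₀
    real₂ = δ≡0⇒real (m+n≡0⇒m≡0 (δ (k 2)) rest₁)
    π = recolouring (k 1) (k 2)
    π-clash = recolouring-clash real₁ real₂ (kk 1)
    G′ = recolour G π π-clash
    rest≡0 : ∑ (1 + t + (3 + t)) (λ j → δ (π (k (3 + j)))) ≡ 0
    rest≡0 = trans (∑-cong (1 + t + (3 + t)) λ j → recolouring-δ (k 1) (k 2) (k (3 + j))) (m+n≡0⇒n≡0 (δ (k 2)) rest₁)

  two-holes : z ≢ none → k 0 ≡ none → holes G ≡ 2 → ¬ Refuted (3 + t + (3 + t)) red (none ∷ []) 1 0 n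
  two-holes z≢ k₀ two = refuted-as G′ 1 _ (recolouring-first (next z) z≢) (cong (λ u → π u ∷ []) k₀)
    refl (≤-reflexive rest≡1)
    (≤-trans (≤-reflexive (sym (trans (∑-cong n (π-δ ∘ k)) two))) (≤-trans (m≤n+m _ (δ (π z))) (m≤m+n _ 0)))
    (≤-trans (≤-reflexive (recolour-total G π π-clash π-δ)) total≤)
    where
    -- The aim is to send `z` to `red`; `next z` merely supplies a second colour different from it.
    π = recolouring z (next z)
    π-δ = recolouring-δ z (next z)
    π-clash = recolouring-clash z≢ (next-real z≢) (next-⟂ z)
    G′ = recolour G π π-clash
    rest≡1 : ∑ (3 + t + (3 + t)) (λ j → δ (π (k (1 + j)))) ≡ 1
    rest≡1 = trans (∑-cong (3 + t + (3 + t)) λ j → π-δ (k (1 + j)))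
      (suc-injective (trans (cong (λ v → δ v + ∑ (3 + t + (3 + t)) (δ ∘ k ∘ suc)) (sym k₀)) two))

-- The rim length is `7 + 2 * t`: the searches cover `n = 7` and `n = 9`, and with one hole below a
-- deleted hub also `n = 11`.
full-hub-row-refuted : ∀ t → t ≤ 1 → Refuted (2 + t + (3 + t)) none (red ∷ green ∷ []) 0 1 (suc (3 + t + (3 + t)))
full-hub-row-refuted 0 _ = by-search refl
full-hub-row-refuted 1 _ = by-search refl
full-hub-row-refuted (suc (suc _)) (s≤s ())

one-hole-refuted : ∀ t → t ≤ 2 → Refuted (1 + t + (3 + t)) none (none ∷ red ∷ green ∷ []) 0 0 (suc (3 + t + (3 + t)))
one-hole-refuted 0 _ = by-search refl
one-hole-refuted 1 _ = by-search refl
one-hole-refuted 2 _ = by-search refl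
one-hole-refuted (suc (suc (suc _))) (s≤s (s≤s ()))

two-holes-refuted : ∀ t → t ≤ 1 → Refuted (3 + t + (3 + t)) red (none ∷ []) 1 0 (suc (3 + t + (3 + t)))
two-holes-refuted 0 _ = by-search refl
two-holes-refuted 1 _ = by-search refl
two-holes-refuted (suc (suc _)) (s≤s ())

module _ {t} (G : Grid (3 + t)) where
  open Grid G

  small : ∀ c → n ≤ 8 + (c + c) → t ≤ c
  small c n≤ = ≮⇒≥ λ c<t → <⇒≱ (s≤s (≤-trans (≤-reflexive (lemma c)) (+-mono-≤ (+-monoʳ-≤ 3 c<t) (+-monoʳ-≤ 3 c<t)))) n≤
    where
    lemma : ∀ c → 8 + (c + c) ≡ 3 + suc c + (3 + suc c)
    lemma = solve-∀

  module _ (total≤ : total ≤ 2 + n) where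

    hubRow≤2 : hubRow ≤ 2
    hubRow≤2 = +-cancelʳ-≤ n _ _ (≤-trans hubRow+n≤total total≤)

    near-size : ∀ {a b c} → δ z ≡ a → holes G ≡ b → length (turnWindows G) ≤ c → a + b + n ≤ 2 + (5 * b + c)
    near-size refl refl T≤ = ≤-trans (covered-size G (near-bound G) total≤) (+-monoʳ-≤ 2 (+-monoʳ-≤ (5 * holes G) T≤))

    turn-size : ∀ {a b} → δ z ≡ a → holes G ≡ b → (∀ a → a ≢ none → Turning G a) → a + b + n ≤ 2 + (b + 9)
    turn-size refl refl turning = ≤-trans (covered-size G (turn-bound G turning) total≤) (+-monoʳ-≤ 2 (+-monoʳ-≤ (holes G) (turnWindows≤9 G)))

    rotated : ∀ {b} → holes G ≡ suc b → ∃ λ (G′ : Grid (3 + t)) →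
      Grid.z G′ ≡ z × Grid.k G′ 0 ≡ none × holes G′ ≡ suc b × Grid.total G′ ≤ 2 + n
    rotated {b} eq with hole-below-n G (subst (1 ≤_) (sym eq) (s≤s z≤n))
    ... | p , kp = rotate G p , refl , kp , trans (rotate-holes G p) eq , ≤-trans (≤-reflexive (rotate-total G p)) total≤

    deleted-hub : z ≡ none → ∀ b → holes G ≡ b → ⊥
    -- At most nine turn columns give `1 + n ≤ 11`, so `n` is 7 or 9.
    deleted-hub z≡ 0 eq = full-hub-row G total≤ z≡ eq
      (full-hub-row-refuted t (small 1 (s≤s⁻¹ (near-size (cong δ z≡) eq (turnWindows≤9 G)))))
    deleted-hub z≡ 1 eq with rotated eq
    ... | G′ , z′≡ , k₀ , eq′ , total′≤ = one-hole G′ total′≤ (trans z′≡ z≡) k₀ eq′ (one-hole-refuted t (small 2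
      -- If every colour turns, then `2 + n ≤ 12`; otherwise there are at most six turn columns and
      -- `2 + n ≤ 13`. In both cases `n ≤ 11`.
      ([ (λ turning → ≤-trans (s≤s⁻¹ (s≤s⁻¹ (turn-size (cong δ z≡) eq turning))) (m≤n+m 10 2))
       , (λ T≤6 → ≤-trans (s≤s⁻¹ (s≤s⁻¹ (near-size (cong δ z≡) eq T≤6))) (n≤1+n 11)) ]′ (turning-or-short G))))
    deleted-hub z≡ (suc (suc b)) eq with ≤-trans (≤-reflexive (sym (cong₂ (λ v s → δ v + s) z≡ eq))) hubRow≤2
    ... | s≤s (s≤s ())

    real-hub-cell : z ≢ none → δ z ≡ 0 → ∀ b → holes G ≡ b → ⊥
    real-hub-cell z≢ δz≡0 0 eq with subst (1 ≤_) (cong₂ _+_ δz≡0 eq) 1≤hubRow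
    ... | ()
    -- A coloured hub admits no turns, so the count reads `1 + n ≤ 7`, whereas `n` is at least 7.
    real-hub-cell z≢ δz≡0 1 eq = <⇒≱ (s≤s (≤-trans (m≤m+n 6 (t + t)) (≤-reflexive (lemma t))))
      (s≤s⁻¹ (near-size δz≡0 eq (≤-reflexive (real-hub G z≢))))
      where
      lemma : ∀ t → 6 + (t + t) ≡ 3 + t + (3 + t)
      lemma = solve-∀
    real-hub-cell z≢ δz≡0 2 eq with rotated eq
    -- Two windows of five columns and no turns give `2 + n ≤ 12`, so `n` is 7 or 9.
    ... | G′ , refl , k₀ , eq′ , total′≤ = two-holes G′ total′≤ z≢ k₀ eq′ (two-holes-refuted t (small 1
      (s≤s⁻¹ (s≤s⁻¹ (near-size δz≡0 eq (≤-reflexive (real-hub G z≢)))))))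
    real-hub-cell z≢ δz≡0 (suc (suc (suc b))) eq with ≤-trans (≤-reflexive (sym (cong₂ _+_ δz≡0 eq))) hubRow≤2
    ... | s≤s (s≤s ())

    -- The rim rows take `n` of the at most `n + 2` deletions, so the hub row has one or two: a
    -- deleted hub with at most one hole, or a coloured hub with one or two holes. Counting columns
    -- bounds `n` in each case, and the searches settle the lengths that remain.
    impossible : ⊥
    impossible with deleted z in eq
    ... | true  = deleted-hub (deleted⇒none z eq) (holes G) refl
    ... | false = real-hub-cell (δ≡0⇒real (δ≡0 z eq)) (δ≡0 z eq) (holes G) refl
      where
      δ≡0 : ∀ v → deleted v ≡ false → δ v ≡ 0
      δ≡0 red   _ = refl
      δ≡0 green _ = refl
      δ≡0 blue  _ = refl

  deletions : 3 + n ≤ total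
  deletions = ≰⇒> impossible

-- Averaging over the triangles of a power

sum-++ : ∀ m {n} (f : Fin (m + n) → ℕ) → sum f ≡ sum (λ i → f (i ↑ˡ n)) + sum (λ j → f (m ↑ʳ j))
sum-++ zero    f = refl
sum-++ (suc m) f = trans (cong (f Fin.zero +_) (sum-++ m (f ∘ Fin.suc))) (sym (+-assoc (f Fin.zero) _ _))

sum-combine : ∀ m n (f : Fin (m * n) → ℕ) → sum f ≡ sum {m} (λ i → sum {n} (λ j → f (combine i j)))
sum-combine zero    n f = refl
sum-combine (suc m) n f = trans (sum-++ n f)
  (cong (sum (λ j → f (j ↑ˡ (m * n))) +_) (sum-combine m n (f ∘ (n ↑ʳ_))))

sum-mono : ∀ {n} {f g : Fin n → ℕ} → (∀ i → f i ≤ g i) → sum f ≤ sum g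
sum-mono {zero}  f≤g = z≤n
sum-mono {suc n} f≤g = +-mono-≤ (f≤g Fin.zero) (sum-mono (f≤g ∘ Fin.suc))

sum-const : ∀ n c → sum {n} (λ _ → c) ≡ c * n
sum-const zero    c = sym (*-zeroʳ c)
sum-const (suc n) c = trans (cong (c +_) (sum-const n c)) (sym (*-suc c n))

∑ᵥ : (G : Graph) → (V G → ℕ) → ℕ
∑ᵥ G f = sum {order G} (f ∘ vertex G)

module _ (G : Graph) where

  ∑ᵥ-cong : ∀ {f g : V G → ℕ} → (∀ v → f v ≡ g v) → ∑ᵥ G f ≡ ∑ᵥ G g
  ∑ᵥ-cong f≗g = sum-cong-≗ {order G} (f≗g ∘ vertex G)

  ∑ᵥ-+ : ∀ f g → ∑ᵥ G (λ v → f v + g v) ≡ ∑ᵥ G f + ∑ᵥ G g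
  ∑ᵥ-+ f g = ∑-distrib-+ {order G} (f ∘ vertex G) (g ∘ vertex G)

  ∑ᵥ-* : ∀ c f → ∑ᵥ G (λ v → c * f v) ≡ c * ∑ᵥ G f
  ∑ᵥ-* c f = sym (*-distribˡ-sum {order G} c (f ∘ vertex G))

  ∑ᵥ-mono : ∀ {f g : V G → ℕ} → (∀ v → f v ≤ g v) → ∑ᵥ G f ≤ ∑ᵥ G g
  ∑ᵥ-mono f≤g = sum-mono {order G} (f≤g ∘ vertex G)

  ∑ᵥ-const : ∀ c → ∑ᵥ G (λ _ → c) ≡ c * order G
  ∑ᵥ-const = sum-const (order G)

module _ (G H : Graph) where

  ∑ᵥ-□ : ∀ f → ∑ᵥ (G □ H) f ≡ ∑ᵥ G (λ u → ∑ᵥ H (λ x → f (u , x)))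
  ∑ᵥ-□ f = trans (sum-combine (order G) (order H) _)
    (sum-cong-≗ {order G} λ i → sum-cong-≗ {order H} λ j →
      cong (λ (u , x) → f (vertex G u , vertex H x)) (remQuot-combine i j))

  ∑ᵥ-swap : ∀ (f : V G → V H → ℕ) → ∑ᵥ G (λ u → ∑ᵥ H (f u)) ≡ ∑ᵥ H (λ x → ∑ᵥ G (λ u → f u x))
  ∑ᵥ-swap f = ∑-comm {order G} {order H} (λ i j → f (vertex G i) (vertex H j))

  ∑ᵥ-fst : ∀ f → ∑ᵥ (G □ H) (f ∘ proj₁) ≡ order H * ∑ᵥ G f
  ∑ᵥ-fst f = trans (∑ᵥ-□ (f ∘ proj₁)) (trans (∑ᵥ-cong G λ u → trans (∑ᵥ-const H (f u)) (*-comm (f u) (order H))) (∑ᵥ-* G (order H) f))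

  ∑ᵥ-snd : ∀ f → ∑ᵥ (G □ H) (f ∘ proj₂) ≡ order G * ∑ᵥ H f
  ∑ᵥ-snd f = trans (∑ᵥ-□ (f ∘ proj₂)) (trans (∑ᵥ-const G (∑ᵥ H f)) (*-comm (∑ᵥ H f) (order G)))

  ∑ᵥ-product : ∀ f g → ∑ᵥ (G □ H) (λ v → f (proj₁ v) * g (proj₂ v)) ≡ ∑ᵥ G f * ∑ᵥ H g
  ∑ᵥ-product f g = trans (∑ᵥ-□ (λ v → f (proj₁ v) * g (proj₂ v))) (trans (∑ᵥ-cong G λ u → trans (∑ᵥ-* H (f u) g) (*-comm (f u) _))
    (trans (∑ᵥ-* G (∑ᵥ H g) f) (*-comm (∑ᵥ H g) _)))

TriangleBound : (G : Graph) → (V G → ℕ) → ℕ → Set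
TriangleBound G f β = ∀ u v w → Adj G u v → Adj G v w → Adj G u w → f u + f v + f w ≤ β

-- For G = W n ^□ m, the weight a of a vertex is N times its number of hub
-- coordinates. It has mean m and variance m n, and the last field results
-- from summing over all triangles that vary in a single coordinate.
record Spread (n′ : ℕ) (G : Graph) (m : ℕ) : Set where
  n : ℕ
  n = 2 + n′
  N : ℕ
  N = 1 + n
  field
    a         : V G → ℕ
    mean      : ∑ᵥ G a ≡ m * order G
    square    : ∑ᵥ G (λ v → a v * a v) ≡ (m * m + m * n) * order G
    triangles : ∀ f β → TriangleBound G f β →
      N * (2 * m * ∑ᵥ G f) + n′ * ∑ᵥ G (λ v → a v * f v) ≤ m * n * β * order G

module _ {n′ G H m l} (A : Spread n′ G m) (B : Spread n′ H l) where
  private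
    module A = Spread A
    module B = Spread B
    n = 2 + n′
    N = 1 + n

  -- The weights of the two coordinates add up and are independent, so means and variances add. For
  -- the triangles, each factor contributes its inequality summed over all its copies in the
  -- product.
  spread-□ : Spread n′ (G □ H) (m + l)
  spread-□ = record
    { a = λ (u , x) → A.a u + B.a x
    ; mean = mean
    ; square = square
    ; triangles = triangles }
    where
    open ≡-Reasoning
    mean : ∑ᵥ (G □ H) (λ (u , x) → A.a u + B.a x) ≡ (m + l) * (order G * order H)
    mean = begin
      ∑ᵥ (G □ H) (λ (u , x) → A.a u + B.a x)                     ≡⟨ ∑ᵥ-+ (G □ H) (A.a ∘ proj₁) (B.a ∘ proj₂) ⟩
      ∑ᵥ (G □ H) (A.a ∘ proj₁) + ∑ᵥ (G □ H) (B.a ∘ proj₂)        ≡⟨ cong₂ _+_ (∑ᵥ-fst G H A.a) (∑ᵥ-snd G H B.a) ⟩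
      order H * ∑ᵥ G A.a + order G * ∑ᵥ H B.a                    ≡⟨ cong₂ (λ s t → order H * s + order G * t) A.mean B.mean ⟩
      order H * (m * order G) + order G * (l * order H)          ≡⟨ lemma m l (order G) (order H) ⟩
      (m + l) * (order G * order H)                              ∎
      where
      lemma : ∀ m l p q → q * (m * p) + p * (l * q) ≡ (m + l) * (p * q)
      lemma = solve-∀

    square : ∑ᵥ (G □ H) (λ (u , x) → (A.a u + B.a x) * (A.a u + B.a x)) ≡ ((m + l) * (m + l) + (m + l) * n) * (order G * order H)
    square = begin
      ∑ᵥ (G □ H) (λ (u , x) → (A.a u + B.a x) * (A.a u + B.a x))
        ≡⟨ ∑ᵥ-cong (G □ H) (λ (u , x) → expand (A.a u) (B.a x)) ⟩
      ∑ᵥ (G □ H) (λ (u , x) → A.a u * A.a u + B.a x * B.a x + 2 * (A.a u * B.a x))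
        ≡⟨ ∑ᵥ-+ (G □ H) (λ (u , x) → A.a u * A.a u + B.a x * B.a x) (λ (u , x) → 2 * (A.a u * B.a x)) ⟩
      ∑ᵥ (G □ H) (λ (u , x) → A.a u * A.a u + B.a x * B.a x) + ∑ᵥ (G □ H) (λ (u , x) → 2 * (A.a u * B.a x))
        ≡⟨ cong₂ _+_ (∑ᵥ-+ (G □ H) (λ (u , x) → A.a u * A.a u) (λ (u , x) → B.a x * B.a x))
                     (∑ᵥ-* (G □ H) 2 (λ (u , x) → A.a u * B.a x)) ⟩
      ∑ᵥ (G □ H) (λ (u , x) → A.a u * A.a u) + ∑ᵥ (G □ H) (λ (u , x) → B.a x * B.a x) + 2 * ∑ᵥ (G □ H) (λ (u , x) → A.a u * B.a x)
        ≡⟨ cong₂ _+_ (cong₂ _+_ (∑ᵥ-fst G H (λ u → A.a u * A.a u)) (∑ᵥ-snd G H (λ x → B.a x * B.a x)))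
                     (cong (2 *_) (∑ᵥ-product G H A.a B.a)) ⟩
      order H * ∑ᵥ G (λ u → A.a u * A.a u) + order G * ∑ᵥ H (λ x → B.a x * B.a x) + 2 * (∑ᵥ G A.a * ∑ᵥ H B.a)
        ≡⟨ cong₂ _+_ (cong₂ (λ s t → order H * s + order G * t) A.square B.square) (cong₂ (λ s t → 2 * (s * t)) A.mean B.mean) ⟩
      order H * ((m * m + m * n) * order G) + order G * ((l * l + l * n) * order H) + 2 * (m * order G * (l * order H))
        ≡⟨ lemma m l n (order G) (order H) ⟩
      ((m + l) * (m + l) + (m + l) * n) * (order G * order H) ∎
      where
      expand : ∀ a b → (a + b) * (a + b) ≡ a * a + b * b + 2 * (a * b)
      expand = solve-∀
      lemma : ∀ m l n p q → q * ((m * m + m * n) * p) + p * ((l * l + l * n) * q) + 2 * (m * p * (l * q))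
            ≡ ((m + l) * (m + l) + (m + l) * n) * (p * q)
      lemma = solve-∀

    triangles : ∀ f β → TriangleBound (G □ H) f β →
      N * (2 * (m + l) * ∑ᵥ (G □ H) f) + n′ * ∑ᵥ (G □ H) (λ (u , x) → (A.a u + B.a x) * f (u , x))
        ≤ (m + l) * n * β * (order G * order H)
    triangles f β bound = ≤R.begin
      N * (2 * (m + l) * S) + n′ * ∑ᵥ (G □ H) (λ (u , x) → (A.a u + B.a x) * f (u , x))
        ≤R.≡⟨ cong (λ s → N * (2 * (m + l) * S) + n′ * s) (trans
               (∑ᵥ-cong (G □ H) λ (u , x) → *-distribʳ-+ (f (u , x)) (A.a u) (B.a x))
               (∑ᵥ-+ (G □ H) fA fB)) ⟩
      N * (2 * (m + l) * S) + n′ * (SA + SB)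
        ≤R.≡⟨ split N m l n′ S SA SB ⟩
      (N * (2 * m * S) + n′ * SA) + (N * (2 * l * S) + n′ * SB)
        ≤R.≤⟨ +-mono-≤ left right ⟩
      order H * (m * n * β * order G) + order G * (l * n * β * order H)
        ≤R.≡⟨ merge m l n β (order G) (order H) ⟩
      (m + l) * n * β * (order G * order H) ≤R.∎
      where
      module ≤R = ≤-Reasoning
      fA fB : V G × V H → ℕ
      fA (u , x) = A.a u * f (u , x)
      fB (u , x) = B.a x * f (u , x)
      S SA SB : ℕ
      S  = ∑ᵥ (G □ H) f
      SA = ∑ᵥ (G □ H) fA
      SB = ∑ᵥ (G □ H) fB
      split : ∀ N m l n′ S SA SB → N * (2 * (m + l) * S) + n′ * (SA + SB) ≡ (N * (2 * m * S) + n′ * SA) + (N * (2 * l * S) + n′ * SB)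
      split = solve-∀
      merge : ∀ m l n β p q → q * (m * n * β * p) + p * (l * n * β * q) ≡ (m + l) * n * β * (p * q)
      merge = solve-∀

      fibre : ∀ K c d (g g′ : V K → ℕ) → N * (c * ∑ᵥ K g) + d * ∑ᵥ K g′ ≡ ∑ᵥ K (λ v → N * (c * g v) + d * g′ v)
      fibre K c d g g′ = sym (trans (∑ᵥ-+ K (λ v → N * (c * g v)) (λ v → d * g′ v))
        (cong₂ _+_ (trans (∑ᵥ-* K N (λ v → c * g v)) (cong (N *_) (∑ᵥ-* K c g))) (∑ᵥ-* K d g′)))

      left : N * (2 * m * S) + n′ * SA ≤ order H * (m * n * β * order G)
      left = ≤R.begin
        N * (2 * m * S) + n′ * SA
          ≤R.≡⟨ cong₂ (λ s t → N * (2 * m * s) + n′ * t) (trans (∑ᵥ-□ G H f) (∑ᵥ-swap G H λ u x → f (u , x)))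
               (trans (∑ᵥ-□ G H fA) (∑ᵥ-swap G H λ u x → fA (u , x))) ⟩
        N * (2 * m * ∑ᵥ H (λ x → ∑ᵥ G (λ u → f (u , x)))) + n′ * ∑ᵥ H (λ x → ∑ᵥ G (λ u → A.a u * f (u , x)))
          ≤R.≡⟨ fibre H (2 * m) n′ (λ x → ∑ᵥ G (λ u → f (u , x))) (λ x → ∑ᵥ G (λ u → fA (u , x))) ⟩
        ∑ᵥ H (λ x → N * (2 * m * ∑ᵥ G (λ u → f (u , x))) + n′ * ∑ᵥ G (λ u → A.a u * f (u , x)))
          ≤R.≤⟨ ∑ᵥ-mono H (λ x → A.triangles (λ u → f (u , x)) β λ u v w uv vw uw →
                 bound (u , x) (v , x) (w , x) (inj₂ (refl , uv)) (inj₂ (refl , vw)) (inj₂ (refl , uw))) ⟩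
        ∑ᵥ H (λ _ → m * n * β * order G)
          ≤R.≡⟨ trans (∑ᵥ-const H _) (*-comm _ (order H)) ⟩
        order H * (m * n * β * order G) ≤R.∎

      right : N * (2 * l * S) + n′ * SB ≤ order G * (l * n * β * order H)
      right = ≤R.begin
        N * (2 * l * S) + n′ * SB
          ≤R.≡⟨ cong₂ (λ s t → N * (2 * l * s) + n′ * t) (∑ᵥ-□ G H f) (∑ᵥ-□ G H fB) ⟩
        N * (2 * l * ∑ᵥ G (λ u → ∑ᵥ H (λ x → f (u , x)))) + n′ * ∑ᵥ G (λ u → ∑ᵥ H (λ x → B.a x * f (u , x)))
          ≤R.≡⟨ fibre G (2 * l) n′ (λ u → ∑ᵥ H (λ x → f (u , x))) (λ u → ∑ᵥ H (λ x → fB (u , x))) ⟩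
        ∑ᵥ G (λ u → N * (2 * l * ∑ᵥ H (λ x → f (u , x))) + n′ * ∑ᵥ H (λ x → B.a x * f (u , x)))
          ≤R.≤⟨ ∑ᵥ-mono G (λ u → B.triangles (λ x → f (u , x)) β λ x y z xy yz xz →
                 bound (u , x) (u , y) (u , z) (inj₁ (refl , xy)) (inj₁ (refl , yz)) (inj₁ (refl , xz))) ⟩
        ∑ᵥ G (λ _ → l * n * β * order H)
          ≤R.≡⟨ trans (∑ᵥ-const G _) (*-comm _ (order G)) ⟩
        order G * (l * n * β * order H) ≤R.∎

∣-∣-square : ∀ a b → 2 * (a * b) + ∣ a - b ∣ * ∣ a - b ∣ ≡ a * a + b * b
∣-∣-square a b with ≤-total a b
... | inj₁ a≤b = subst (λ b → 2 * (a * b) + ∣ a - b ∣ * ∣ a - b ∣ ≡ a * a + b * b) (m+[n∸m]≡n a≤b)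
  (subst (λ d → 2 * (a * (a + (b ∸ a))) + d * d ≡ a * a + (a + (b ∸ a)) * (a + (b ∸ a))) (sym (∣m-m+n∣≡n a (b ∸ a))) (lemma a (b ∸ a)))
  where
  lemma : ∀ a d → 2 * (a * (a + d)) + d * d ≡ a * a + (a + d) * (a + d)
  lemma = solve-∀
... | inj₂ b≤a = subst (λ a → 2 * (a * b) + ∣ a - b ∣ * ∣ a - b ∣ ≡ a * a + b * b) (m+[n∸m]≡n b≤a)
  (subst (λ d → 2 * ((b + (a ∸ b)) * b) + d * d ≡ (b + (a ∸ b)) * (b + (a ∸ b)) + b * b)
    (sym (trans (∣-∣-comm (b + (a ∸ b)) b) (∣m-m+n∣≡n b (a ∸ b)))) (lemma b (a ∸ b)))
  where
  lemma : ∀ b d → 2 * ((b + d) * b) + d * d ≡ (b + d) * (b + d) + b * b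
  lemma = solve-∀

2*≤squares : ∀ s d → 2 * (s * d) ≤ s * s + d * d
2*≤squares s d = ≤-trans (m≤m+n _ (∣ s - d ∣ * ∣ s - d ∣)) (≤-reflexive (∣-∣-square s d))

-- By Chebyshev the weight is close to its mean at most vertices, where the
-- triangles cover all vertices equally often.
module _ {n′ G m} (A : Spread n′ G m) where
  open Spread A

  variance : ∑ᵥ G (λ v → ∣ a v - m ∣ * ∣ a v - m ∣) ≡ m * n * order G
  variance = +-cancelˡ-≡ (2 * m * (m * order G)) _ _ (begin
    2 * m * (m * order G) + ∑ᵥ G (λ v → ∣ a v - m ∣ * ∣ a v - m ∣)
      ≡⟨ cong (λ s → 2 * m * s + ∑ᵥ G (λ v → ∣ a v - m ∣ * ∣ a v - m ∣)) mean ⟨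
    2 * m * ∑ᵥ G a + ∑ᵥ G (λ v → ∣ a v - m ∣ * ∣ a v - m ∣)
      ≡⟨ cong (_+ ∑ᵥ G (λ v → ∣ a v - m ∣ * ∣ a v - m ∣)) (∑ᵥ-* G (2 * m) a) ⟨
    ∑ᵥ G (λ v → 2 * m * a v) + ∑ᵥ G (λ v → ∣ a v - m ∣ * ∣ a v - m ∣)
      ≡⟨ ∑ᵥ-+ G (λ v → 2 * m * a v) (λ v → ∣ a v - m ∣ * ∣ a v - m ∣) ⟨
    ∑ᵥ G (λ v → 2 * m * a v + ∣ a v - m ∣ * ∣ a v - m ∣)
      ≡⟨ ∑ᵥ-cong G (λ v → trans (cong (_+ ∣ a v - m ∣ * ∣ a v - m ∣) (comm m (a v))) (∣-∣-square (a v) m)) ⟩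
    ∑ᵥ G (λ v → a v * a v + m * m)
      ≡⟨ ∑ᵥ-+ G (λ v → a v * a v) (λ _ → m * m) ⟩
    ∑ᵥ G (λ v → a v * a v) + ∑ᵥ G (λ _ → m * m)
      ≡⟨ cong₂ _+_ square (∑ᵥ-const G (m * m)) ⟩
    (m * m + m * n) * order G + m * m * order G
      ≡⟨ lemma m n (order G) ⟩
    2 * m * (m * order G) + m * n * order G ∎)
    where
    open ≡-Reasoning
    comm : ∀ m a → 2 * m * a ≡ 2 * (a * m)
    comm = solve-∀
    lemma : ∀ m n p → (m * m + m * n) * p + m * m * p ≡ 2 * m * (m * p) + m * n * p
    lemma = solve-∀

  -- If every weight equalled its mean `m`, `triangles` would read
  -- `3 * n * m * F ≤ m * n * β * order G`, since `2 * N + n′ = 3 * n`. The deviation `D` from the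
  -- mean is absorbed by `2 * s * D ≤ s * s + D * D` and the variance; `s` is a free parameter,
  -- balanced against `m` later.
  averaging : ∀ f β B s → TriangleBound G f β → (∀ v → f v ≤ B) →
    2 * s * m * (3 * n * ∑ᵥ G f) ≤ (2 * s * m * n * β + n′ * B * (m * n + s * s)) * order G
  averaging f β B s bound f≤B = +-cancelʳ-≤ (2 * s * n′ * T) _ _ (begin
    2 * s * m * (3 * n * F) + 2 * s * n′ * T                             ≡⟨ lemma₁ s m n′ F T ⟩
    n′ * (2 * s * m * F) + 2 * s * (N * (2 * m * F) + n′ * T)
      ≤⟨ +-mono-≤ (*-monoʳ-≤ n′ deviation) (*-monoʳ-≤ (2 * s) (triangles f β bound)) ⟩
    n′ * (2 * s * T + B * (m * n + s * s) * order G) + 2 * s * (m * n * β * order G)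
      ≡⟨ lemma₂ n′ s T (B * (m * n + s * s)) (order G) (m * n) β ⟩
    (2 * s * (m * n) * β + n′ * (B * (m * n + s * s))) * order G + 2 * s * n′ * T
      ≡⟨ cong (λ c → c * order G + 2 * s * n′ * T) (cong₂ _+_ (lemma₃ s m n β) (sym (*-assoc n′ B _))) ⟩
    (2 * s * m * n * β + n′ * B * (m * n + s * s)) * order G + 2 * s * n′ * T ∎)
    where
    open ≤-Reasoning
    F T : ℕ
    F = ∑ᵥ G f
    T = ∑ᵥ G (λ v → a v * f v)
    lemma₁ : ∀ s m n′ F T → 2 * s * m * (3 * (2 + n′) * F) + 2 * s * n′ * T
           ≡ n′ * (2 * s * m * F) + 2 * s * ((1 + (2 + n′)) * (2 * m * F) + n′ * T)
    lemma₁ = solve-∀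
    lemma₂ : ∀ n′ s T c p mn β → n′ * (2 * s * T + c * p) + 2 * s * (mn * β * p)
           ≡ (2 * s * mn * β + n′ * c) * p + 2 * s * n′ * T
    lemma₂ = solve-∀
    lemma₃ : ∀ s m n β → 2 * s * (m * n) * β ≡ 2 * s * m * n * β
    lemma₃ = solve-∀

    D : V G → ℕ
    D v = ∣ a v - m ∣

    pointwise : ∀ v → 2 * s * m * f v ≤ 2 * s * (a v * f v) + B * (D v * D v + s * s)
    pointwise v = begin
      2 * s * m * f v                                          ≤⟨ *-monoˡ-≤ (f v) (*-monoʳ-≤ (2 * s) (m≤∣-∣+ (a v) m)) ⟩
      2 * s * (a v + D v) * f v                                ≡⟨ lemma₄ s (a v) (D v) (f v) ⟩
      2 * s * (a v * f v) + 2 * (s * D v) * f v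
        ≤⟨ +-monoʳ-≤ (2 * s * (a v * f v)) (*-mono-≤ (2*≤squares s (D v)) (f≤B v)) ⟩
      2 * s * (a v * f v) + (s * s + D v * D v) * B            ≡⟨ cong (2 * s * (a v * f v) +_) (lemma₅ (s * s) (D v * D v) B) ⟩
      2 * s * (a v * f v) + B * (D v * D v + s * s)            ∎
      where
      m≤∣-∣+ : ∀ a m → m ≤ a + ∣ a - m ∣
      m≤∣-∣+ a m = ≤-trans (m≤n+∣m-n∣ m a) (+-monoʳ-≤ a (≤-reflexive (∣-∣-comm m a)))
      lemma₄ : ∀ s a d f → 2 * s * (a + d) * f ≡ 2 * s * (a * f) + 2 * (s * d) * f
      lemma₄ = solve-∀
      lemma₅ : ∀ x y b → (x + y) * b ≡ b * (y + x)
      lemma₅ = solve-∀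

    deviation : 2 * s * m * F ≤ 2 * s * T + B * (m * n + s * s) * order G
    deviation = begin
      2 * s * m * F                                            ≡⟨ ∑ᵥ-* G (2 * s * m) f ⟨
      ∑ᵥ G (λ v → 2 * s * m * f v)                             ≤⟨ ∑ᵥ-mono G pointwise ⟩
      ∑ᵥ G (λ v → 2 * s * (a v * f v) + B * (D v * D v + s * s))
        ≡⟨ ∑ᵥ-+ G (λ v → 2 * s * (a v * f v)) (λ v → B * (D v * D v + s * s)) ⟩
      ∑ᵥ G (λ v → 2 * s * (a v * f v)) + ∑ᵥ G (λ v → B * (D v * D v + s * s))
        ≡⟨ cong₂ _+_ (∑ᵥ-* G (2 * s) (λ v → a v * f v)) (trans (∑ᵥ-* G B (λ v → D v * D v + s * s))
             (cong (B *_) (trans (∑ᵥ-+ G (λ v → D v * D v) (λ _ → s * s)) (cong₂ _+_ variance (∑ᵥ-const G (s * s)))))) ⟩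
      2 * s * T + B * (m * n * order G + s * s * order G)
        ≡⟨ cong (2 * s * T +_) (lemma₆ B (m * n) (s * s) (order G)) ⟩
      2 * s * T + B * (m * n + s * s) * order G                ∎
      where
      lemma₆ : ∀ b x y p → b * (x * p + y * p) ≡ b * (x + y) * p
      lemma₆ = solve-∀

-- Independent sets in the powers of a wheel

module _ (n′ : ℕ) where
  private
    n : ℕ
    n = 2 + n′

  rim : ℕ → Fin n
  rim j = j mod n

  toℕ-rim : ∀ j → toℕ (rim j) ≡ j % n
  toℕ-rim j = toℕ-fromℕ< (m%n<n j n)

  suc-% : ∀ j → suc j % n ≡ suc (j % n) % n
  suc-% j = begin
    suc j % n                ≡⟨ %-distribˡ-+ 1 j n ⟩
    (1 % n + j % n) % n      ≡⟨ cong (λ s → (1 % n + s) % n) (m%n%n≡m%n j n) ⟨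
    (1 % n + j % n % n) % n  ≡⟨ %-distribˡ-+ 1 (j % n) n ⟨
    suc (j % n) % n          ∎
    where open ≡-Reasoning

  rim-next : ∀ j → Next (rim j) (rim (suc j))
  rim-next j with m≤n⇒m<n∨m≡n (m%n<n j n)
  ... | inj₁ lt = inj₁ (begin
    suc (toℕ (rim j))  ≡⟨ cong suc (toℕ-rim j) ⟩
    suc (j % n)        ≡⟨ m<n⇒m%n≡m lt ⟨
    suc (j % n) % n    ≡⟨ suc-% j ⟨
    suc j % n          ≡⟨ toℕ-rim (suc j) ⟨
    toℕ (rim (suc j))  ∎)
    where open ≡-Reasoning
  ... | inj₂ eq = inj₂ (trans (cong suc (toℕ-rim j)) eq
    , trans (toℕ-rim (suc j)) (trans (suc-% j) (trans (cong (_% n) eq) (n%n≡0 n))))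

  next-≢ : ∀ {i j : Fin n} → Next i j → i ≢ j
  next-≢ (inj₁ eq)         refl = 1+n≢n eq
  next-≢ {i} (inj₂ (eq , i≡0)) refl with trans (sym eq) (cong suc i≡0)
  ... | ()

  rim-adjacent : ∀ j → Adj (C n) (rim j) (rim (suc j))
  rim-adjacent j = next-≢ (rim-next j) , inj₁ (rim-next j)

  rim-periodic : Periodic n rim
  rim-periodic j = toℕ-injective (trans (toℕ-rim (n + j))
    (trans (trans (cong (_% n) (+-comm n j)) ([m+n]%n≡m%n j n)) (sym (toℕ-rim j))))

  ∑-rim : ∀ f → sum {n} f ≡ ∑ n (f ∘ rim)
  ∑-rim f = sum-cong-≗ {n} λ i → cong f (toℕ-injective (sym (trans (toℕ-rim (toℕ i)) (m<n⇒m%n≡m (toℕ<n i)))))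

  hubᵥ : V (W n)
  hubᵥ = inj₁ tt

  rimᵥ : ℕ → V (W n)
  rimᵥ j = inj₂ (rim j)

  ∑-wheel : ∀ f → ∑ᵥ (W n) f ≡ f hubᵥ + ∑ n (f ∘ rimᵥ)
  ∑-wheel f = cong (f hubᵥ +_) (∑-rim (f ∘ inj₂))

  hubWeight : V (W n) → ℕ
  hubWeight (inj₁ _) = 1 + n
  hubWeight (inj₂ _) = 0

  -- Summing over the `n` triangles formed by the hub and two consecutive rim vertices counts the
  -- hub `n` times and each rim vertex twice. The term with `n′ = n - 2` is the surplus at the hub.
  spread-W : Spread n′ (W n) 1
  spread-W = record
    { a = hubWeight
    ; mean = trans (∑-wheel hubWeight) (trans (cong (1 + n +_) (trans (∑-const n 0) (*-zeroʳ n))) (mean n))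
    ; square = trans (∑-wheel (λ v → hubWeight v * hubWeight v)) (trans (cong ((1 + n) * (1 + n) +_) (trans (∑-const n 0) (*-zeroʳ n))) (square n))
    ; triangles = triangles }
    where
    mean : ∀ n → 1 + n + 0 ≡ 1 * (1 + n)
    mean = solve-∀
    square : ∀ n → (1 + n) * (1 + n) + 0 ≡ (1 * 1 + 1 * n) * (1 + n)
    square = solve-∀
    triangles : ∀ f β → TriangleBound (W n) f β →
      (1 + n) * (2 * 1 * ∑ᵥ (W n) f) + n′ * ∑ᵥ (W n) (λ v → hubWeight v * f v) ≤ 1 * n * β * (1 + n)
    triangles f β bound = begin
      (1 + n) * (2 * 1 * ∑ᵥ (W n) f) + n′ * ∑ᵥ (W n) (λ v → hubWeight v * f v)
        ≡⟨ cong₂ (λ s t → (1 + n) * (2 * 1 * s) + n′ * t) (∑-wheel f)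
             (trans (∑-wheel (λ v → hubWeight v * f v)) (cong (hubWeight hubᵥ * f hubᵥ +_) (trans (∑-const n 0) (*-zeroʳ n)))) ⟩
      (1 + n) * (2 * 1 * (f hubᵥ + R)) + n′ * ((1 + n) * f hubᵥ + 0)
        ≡⟨ lemma₁ n′ (f hubᵥ) R ⟩
      (1 + n) * (n * f hubᵥ + R + R)
        ≡⟨ cong (λ r → (1 + n) * (n * f hubᵥ + R + r)) (∑-shift n {f ∘ rimᵥ} (λ j → cong (f ∘ inj₂) (rim-periodic j)) 1) ⟨
      (1 + n) * (n * f hubᵥ + R + ∑ n (λ j → f (rimᵥ (j + 1))))
        ≡⟨ cong ((1 + n) *_) (trans (∑-+ n (λ j → f hubᵥ + f (rimᵥ j)) (λ j → f (rimᵥ (j + 1))))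
             (cong (_+ ∑ n (λ j → f (rimᵥ (j + 1)))) (trans (∑-+ n (λ _ → f hubᵥ) (f ∘ rimᵥ)) (cong (_+ R) (∑-const n (f hubᵥ)))))) ⟨
      (1 + n) * ∑ n (λ j → f hubᵥ + f (rimᵥ j) + f (rimᵥ (j + 1)))
        ≤⟨ *-monoʳ-≤ (1 + n) (∑-mono n λ j _ → bound hubᵥ (rimᵥ j) (rimᵥ (j + 1)) tt
             (subst (λ i → Adj (C n) (rim j) (rim i)) (+-comm 1 j) (rim-adjacent j)) tt) ⟩
      (1 + n) * ∑ n (λ _ → β)
        ≡⟨ trans (cong ((1 + n) *_) (∑-const n β)) (lemma₂ n β) ⟩
      1 * n * β * (1 + n) ∎
      where
      open ≤-Reasoning
      R : ℕ
      R = ∑ n (f ∘ rimᵥ)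
      lemma₁ : ∀ n′ c R → (1 + (2 + n′)) * (2 * 1 * (c + R)) + n′ * ((1 + (2 + n′)) * c + 0)
             ≡ (1 + (2 + n′)) * ((2 + n′) * c + R + R)
      lemma₁ = solve-∀
      lemma₂ : ∀ n β → (1 + n) * (n * β) ≡ 1 * n * β * (1 + n)
      lemma₂ = solve-∀

-- Partial colourings from three disjoint independent sets

paint : Bool → Bool → Bool → Cell
paint b₁ b₂ b₃ = if b₁ then red else if b₂ then green else if b₃ then blue else none

_#_ : Bool → Bool → Set
b # c = b ≡ true → c ≡ true → ⊥

paint-⟂ : ∀ b₁ b₂ b₃ c₁ c₂ c₃ → b₁ # c₁ → b₂ # c₂ → b₃ # c₃ → paint b₁ b₂ b₃ ⟂ paint c₁ c₂ c₃
paint-⟂ true  _     _     true  _     _     p _ _ = ⊥-elim (p refl refl)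
paint-⟂ true  _     _     false true  _     _ _ _ = refl
paint-⟂ true  _     _     false false true  _ _ _ = refl
paint-⟂ true  _     _     false false false _ _ _ = refl
paint-⟂ false true  _     true  _     _     _ _ _ = refl
paint-⟂ false true  _     false true  _     _ p _ = ⊥-elim (p refl refl)
paint-⟂ false true  _     false false true  _ _ _ = refl
paint-⟂ false true  _     false false false _ _ _ = refl
paint-⟂ false false true  true  _     _     _ _ _ = refl
paint-⟂ false false true  false true  _     _ _ _ = refl
paint-⟂ false false true  false false true  _ _ p = ⊥-elim (p refl refl)
paint-⟂ false false true  false false false _ _ _ = refl
paint-⟂ false false false _     _     _     _ _ _ = refl

paint-count : ∀ b₁ b₂ b₃ → b₁ # b₂ → b₂ # b₃ → b₁ # b₃ → ⟦ b₁ ⟧ + ⟦ b₂ ⟧ + ⟦ b₃ ⟧ + δ (paint b₁ b₂ b₃) ≤ 1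
paint-count true  true  _     p _ _ = ⊥-elim (p refl refl)
paint-count true  false true  _ _ p = ⊥-elim (p refl refl)
paint-count true  false false _ _ _ = ≤-refl
paint-count false true  true  _ p _ = ⊥-elim (p refl refl)
paint-count false true  false _ _ _ = ≤-refl
paint-count false false true  _ _ _ = ≤-refl
paint-count false false false _ _ _ = ≤-refl

IndependentSet : (G : Graph) → (V G → Bool) → Set
IndependentSet G S = ∀ {u v} → Adj G u v → S u # S v

module _ (t : ℕ) where
  private
    n n′ : ℕ
    n′ = t + suc t
    n  = 2 + n′

    W² : Graph
    W² = W n □ W n

    hub : V (W n)
    hub = hubᵥ n′

    r : ℕ → V (W n)
    r = rimᵥ n′

  module _ (S₁ S₂ S₃ : V W² → Bool)
    (ind₁ : IndependentSet W² S₁) (ind₂ : IndependentSet W² S₂) (ind₃ : IndependentSet W² S₃)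
    (S₁#S₂ : ∀ v → S₁ v # S₂ v) (S₂#S₃ : ∀ v → S₂ v # S₃ v) (S₁#S₃ : ∀ v → S₁ v # S₃ v) where

    cell : V W² → Cell
    cell v = paint (S₁ v) (S₂ v) (S₃ v)

    cell-⟂ : ∀ {u v} → Adj W² u v → cell u ⟂ cell v
    cell-⟂ e = paint-⟂ _ _ _ _ _ _ (ind₁ e) (ind₂ e) (ind₃ e)

    rim-prev : ∀ j → Adj (C n) (rim n′ (suc j)) (rim n′ j)
    rim-prev j = Graph.sym-Adj (C n) {rim n′ j} {rim n′ (suc j)} (rim-adjacent n′ j)

    r-periodic : Periodic n r
    r-periodic j = cong inj₂ (rim-periodic n′ j)

    grid : Grid (suc t)
    grid = record
      { z = cell (hub , hub) ; k = λ j → cell (hub , r j) ; h = λ i → cell (r i , hub) ; M = λ i j → cell (r i , r j)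
      ; kz = λ j → cell-⟂ (inj₁ (refl , tt))
      ; hz = λ i → cell-⟂ (inj₂ (refl , tt))
      ; kk = λ j → cell-⟂ (inj₁ (refl , rim-prev j))
      ; hh = λ i → cell-⟂ (inj₂ (refl , rim-prev i))
      ; Mk = λ i j → cell-⟂ (inj₂ (refl , tt))
      ; Mh = λ i j → cell-⟂ (inj₁ (refl , tt))
      ; Mʳ = λ i j → cell-⟂ (inj₁ (refl , rim-prev j))
      ; Mᶜ = λ i j → cell-⟂ (inj₂ (refl , rim-prev i))
      ; k-periodic = λ j → cong (λ x → cell (hub , x)) (r-periodic j)
      ; h-periodic = λ i → cong (λ x → cell (x , hub)) (r-periodic i)
      ; Mʳ-periodic = λ i j → cong (λ x → cell (r i , x)) (r-periodic j)
      ; Mᶜ-periodic = λ j i → cong (λ x → cell (x , r j)) (r-periodic i) }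

    ∑-cell : ∑ᵥ W² (δ ∘ cell) ≡ Grid.total grid
    ∑-cell = trans (∑ᵥ-□ (W n) (W n) (δ ∘ cell))
      (trans (∑-wheel n′ (λ u → ∑ᵥ (W n) (λ x → δ (cell (u , x)))))
        (cong₂ _+_ (∑-wheel n′ (λ x → δ (cell (hub , x)))) (∑-cong n λ i → ∑-wheel n′ (λ x → δ (cell (r i , x))))))

    -- By disjointness a vertex is counted at most once: in one of the three sets, or as deleted.
    three-sets : ∑ᵥ W² (⟦_⟧ ∘ S₁) + ∑ᵥ W² (⟦_⟧ ∘ S₂) + ∑ᵥ W² (⟦_⟧ ∘ S₃) + Grid.total grid ≤ (1 + n) * (1 + n)
    three-sets = begin
      ∑ᵥ W² (⟦_⟧ ∘ S₁) + ∑ᵥ W² (⟦_⟧ ∘ S₂) + ∑ᵥ W² (⟦_⟧ ∘ S₃) + Grid.total grid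
        ≡⟨ cong (∑ᵥ W² (⟦_⟧ ∘ S₁) + ∑ᵥ W² (⟦_⟧ ∘ S₂) + ∑ᵥ W² (⟦_⟧ ∘ S₃) +_) ∑-cell ⟨
      ∑ᵥ W² (⟦_⟧ ∘ S₁) + ∑ᵥ W² (⟦_⟧ ∘ S₂) + ∑ᵥ W² (⟦_⟧ ∘ S₃) + ∑ᵥ W² (δ ∘ cell)
        ≡⟨ cong (λ s → s + ∑ᵥ W² (⟦_⟧ ∘ S₃) + ∑ᵥ W² (δ ∘ cell)) (∑ᵥ-+ W² (⟦_⟧ ∘ S₁) (⟦_⟧ ∘ S₂)) ⟨
      ∑ᵥ W² (λ v → ⟦ S₁ v ⟧ + ⟦ S₂ v ⟧) + ∑ᵥ W² (⟦_⟧ ∘ S₃) + ∑ᵥ W² (δ ∘ cell)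
        ≡⟨ cong (_+ ∑ᵥ W² (δ ∘ cell)) (∑ᵥ-+ W² (λ v → ⟦ S₁ v ⟧ + ⟦ S₂ v ⟧) (⟦_⟧ ∘ S₃)) ⟨
      ∑ᵥ W² (λ v → ⟦ S₁ v ⟧ + ⟦ S₂ v ⟧ + ⟦ S₃ v ⟧) + ∑ᵥ W² (δ ∘ cell)
        ≡⟨ ∑ᵥ-+ W² (λ v → ⟦ S₁ v ⟧ + ⟦ S₂ v ⟧ + ⟦ S₃ v ⟧) (δ ∘ cell) ⟨
      ∑ᵥ W² (λ v → ⟦ S₁ v ⟧ + ⟦ S₂ v ⟧ + ⟦ S₃ v ⟧ + δ (cell v))
        ≤⟨ ∑ᵥ-mono W² (λ v → paint-count (S₁ v) (S₂ v) (S₃ v) (S₁#S₂ v) (S₂#S₃ v) (S₁#S₃ v)) ⟩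
      ∑ᵥ W² (λ _ → 1)
        ≡⟨ trans (∑ᵥ-const W² 1) (*-identityˡ _) ⟩
      (1 + n) * (1 + n) ∎
      where open ≤-Reasoning

module _ (G : Graph) (S : Subset (order G)) where

  member : V G → Bool
  member v = lookup S (Inverse.from (Graph.enum G) v)

  ∑-member : ∑ᵥ G (⟦_⟧ ∘ member) ≡ ∣ S ∣
  ∑-member = trans (sum-cong-≗ {order G} λ i → cong (λ i → ⟦ lookup S i ⟧) (Inverse.strictlyInverseʳ (Graph.enum G) i)) (sym (∣∣-sum S))
    where
    ∣∣-sum : ∀ {n} (S : Subset n) → ∣ S ∣ ≡ sum (⟦_⟧ ∘ lookup S)
    ∣∣-sum []          = refl
    ∣∣-sum (true  ∷ S) = cong suc (∣∣-sum S)
    ∣∣-sum (false ∷ S) = ∣∣-sum S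

  member-independent : Independent G S → IndependentSet G member
  member-independent ind {u} {v} e u∈ v∈ = ind _ _ (lookup⇒[]= _ S u∈) (lookup⇒[]= _ S v∈)
    (subst₂ (Adj G) (sym (Inverse.strictlyInverseˡ (Graph.enum G) u)) (sym (Inverse.strictlyInverseˡ (Graph.enum G) v)) e)

-- Sections of an independent set and passage to the limit

open import Data.Integer.Base using (+_)

module _ (n′ : ℕ) where
  private
    n N : ℕ
    n = 2 + n′
    N = 1 + n

  spread-^□ : ∀ m → Spread n′ (W n ^□ suc m) (suc m)
  spread-^□ zero    = spread-W n′
  spread-^□ (suc m) = subst (Spread n′ (W n ^□ suc (suc m))) (+-comm (suc m) 1) (spread-□ {G = W n ^□ suc m} {H = W n} (spread-^□ m) (spread-W n′))

  module _ (G : Graph) where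
    private
      G₂ W² : Graph
      G₂ = G □ W n □ W n
      W² = W n □ W n

    section : (V G₂ → Bool) → V G → V W² → Bool
    section S u (x , y) = S ((u , x) , y)

    sectionSize : (V G₂ → Bool) → V G → ℕ
    sectionSize S u = ∑ᵥ W² (⟦_⟧ ∘ section S u)

    ∑-sections : ∀ S → ∑ᵥ G₂ (⟦_⟧ ∘ S) ≡ ∑ᵥ G (sectionSize S)
    ∑-sections S = trans (∑ᵥ-□ (G □ W n) (W n) (⟦_⟧ ∘ S))
      (trans (∑ᵥ-□ G (W n) (λ p → ∑ᵥ (W n) (λ y → ⟦ S (p , y) ⟧)))
        (∑ᵥ-cong G λ u → sym (∑ᵥ-□ (W n) (W n) (⟦_⟧ ∘ section S u))))

    sectionSize≤ : ∀ S u → sectionSize S u ≤ N * N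
    sectionSize≤ S u = ≤-trans (∑ᵥ-mono W² (λ v → ⟦⟧≤1 (section S u v))) (≤-reflexive (trans (∑ᵥ-const W² 1) (*-identityˡ _)))
      where
      ⟦⟧≤1 : ∀ b → ⟦ b ⟧ ≤ 1
      ⟦⟧≤1 true  = ≤-refl
      ⟦⟧≤1 false = z≤n

    section-independent : ∀ {S} → IndependentSet G₂ S → ∀ u → IndependentSet W² (section S u)
    section-independent ind u (inj₁ (refl , e)) = ind (inj₁ (refl , e))
    section-independent ind u (inj₂ (refl , e)) = ind (inj₂ (refl , inj₁ (refl , e)))

    section-disjoint : ∀ {S} → IndependentSet G₂ S → ∀ {u v} → Adj G u v → ∀ p → section S u p # section S v p
    section-disjoint ind e p = ind (inj₂ (refl , inj₂ (refl , e)))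

  -- The hypothesis is the conclusion cleared of denominators; `mkℚᵘ` stores its denominator less
  -- one, hence `suc q`.
  fraction-≤ : ∀ {a b} O D .{{_ : NonZero O}} .{{_ : NonZero D}} p q →
    a * (D * suc q) ≤ (b * suc q + suc p * D) * O → + a / O ℚ.≤ + b / D ℚ.+ mkℚᵘ +[1+ p ] q
  fraction-≤ {a} {b} O@(suc _) D@(suc _) p q le = ℚ.*≤* (subst₂ ℤ._≤_ (ℤ.pos-* a (D * suc q)) right (ℤ.+≤+ le))
    where
    right : + ((b * suc q + suc p * D) * O) ≡ (+ b ℤ.* + suc q ℤ.+ +[1+ p ] ℤ.* + D) ℤ.* + O
    right = trans (ℤ.pos-* (b * suc q + suc p * D) O) (cong (ℤ._* + O)
      (trans (ℤ.pos-+ (b * suc q) (suc p * D)) (cong₂ ℤ._+_ (ℤ.pos-* b (suc q)) (ℤ.pos-* (suc p) D))))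

  ratios-antitone : ∀ {k l} → k ≤′ l → ratios (W n) l ℚ.≤ ratios (W n) k
  ratios-antitone ≤′-refl           = ℚ.≤-refl
  ratios-antitone (≤′-step {l} k≤l) = ℚ.≤-trans (ratios-mono (W n) l) (ratios-antitone k≤l)

  SectionTriangles : ℕ → Set₁
  SectionTriangles β = ∀ G {S} → IndependentSet (G □ W n □ W n) S → TriangleBound G (sectionSize G S) β

  -- The choice s = N Q turns the error term into 1 / Q.
  cancel-error : ∀ Q .{{_ : NonZero Q}} {m} β P F → let s = N * Q in m ≡ s * s →
    2 * s * m * (3 * n * F) ≤ (2 * s * m * n * β + n′ * (N * N) * (m * n + s * s)) * P →
    3 * Q * F ≤ (Q * β + N * N) * P
  cancel-error Q β P F refl bound = *-cancelˡ-≤ (2 * N * n) (begin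
    2 * N * n * (3 * Q * F)                      ≡⟨ lemma₃ N n Q F ⟩
    2 * s * (3 * n * F)                          ≤⟨ cancelled ⟩
    -- Enlarging `n′` to `2 * n` gives both summands the common factor `2 * N * n`.
    (2 * s * n * β + n′ * (N * N) * N) * P       ≤⟨ *-monoˡ-≤ P (+-monoʳ-≤ (2 * s * n * β) (*-monoˡ-≤ N (*-monoˡ-≤ (N * N) n′≤2n))) ⟩
    (2 * s * n * β + 2 * n * (N * N) * N) * P    ≡⟨ lemma₄ N n Q β P ⟩
    2 * N * n * ((Q * β + N * N) * P)            ∎)
    where
    open ≤-Reasoning
    s : ℕ
    s = N * Q

    n′≤2n : n′ ≤ 2 * n
    n′≤2n = ≤-trans (m≤n+m n′ 2) (m≤m+n n (n + 0))

    lemma₁ : ∀ s n F → 2 * s * (s * s) * (3 * n * F) ≡ s * s * (2 * s * (3 * n * F))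
    lemma₁ = solve-∀
    lemma₂ : ∀ s n β c P → (2 * s * (s * s) * n * β + c * (s * s * n + s * s)) * P ≡ s * s * ((2 * s * n * β + c * (1 + n)) * P)
    lemma₂ = solve-∀
    lemma₃ : ∀ N n Q F → 2 * N * n * (3 * Q * F) ≡ 2 * (N * Q) * (3 * n * F)
    lemma₃ = solve-∀
    lemma₄ : ∀ N n Q β P → (2 * (N * Q) * n * β + 2 * n * (N * N) * N) * P ≡ 2 * N * n * ((Q * β + N * N) * P)
    lemma₄ = solve-∀

    cancelled : 2 * s * (3 * n * F) ≤ (2 * s * n * β + n′ * (N * N) * N) * P
    cancelled = *-cancelˡ-≤ (s * s) {{m*n≢0 s s {{m*n≢0 N Q}} {{m*n≢0 N Q}}}} (≤-trans (≤-reflexive (sym (lemma₁ s n F)))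
      (≤-trans bound (≤-reflexive (lemma₂ s n β (n′ * (N * N)) P))))

  module _ {β} (triangles : SectionTriangles β) where

    α-bound : ∀ Q .{{_ : NonZero Q}} m → suc m ≡ N * Q * (N * Q) →
      3 * Q * α (W n ^□ suc m □ W n □ W n) ≤ (Q * β + N * N) * order (W n ^□ suc m)
    α-bound Q m m≡ = from-set (α-attained G₂)
      where
      G G₂ : Graph
      G  = W n ^□ suc m
      G₂ = G □ W n □ W n

      -- With the independence number generalised to `F`, the size equation can be matched with
      -- `refl`.
      from-set : ∀ {F} → HasIndependentSet G₂ F → 3 * Q * F ≤ (Q * β + N * N) * order G
      from-set (S , ind , refl) = cancel-error Q β (order G) ∣ S ∣ m≡
        (subst (λ F → 2 * (N * Q) * suc m * (3 * n * F) ≤ (2 * (N * Q) * suc m * n * β + n′ * (N * N) * (suc m * n + N * Q * (N * Q))) * order G)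
          (trans (sym (∑-sections G (member G₂ S))) (∑-member G₂ S))
          (averaging (spread-^□ m) (sectionSize G (member G₂ S)) β (N * N) (N * Q)
            (triangles G (λ {u} {v} → member-independent G₂ S ind {u} {v})) (sectionSize≤ G (member G₂ S))))

    limit-bound : ∀ {m} D .{{_ : NonZero D}} → n ≡ m → D ≡ 3 * (N * N) → 𝓘 (W m) ≤ℝ fromℚ (+ β / D)
    -- The term of index `suc (suc m)` is the ratio of `G₂`, the power with `N * Q * (N * Q) + 2`
    -- factors; later terms are no larger.
    limit-bound D refl D≡ (mkℚᵘ +[1+ p ] q) = suc (suc m) , λ k k≥ →
      ℚ.≤-trans (ratios-antitone (≤⇒≤′ k≥)) (fraction-≤ (order G₂) D {{^□-nonZero (W n) (suc (suc m))}} p q (begin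
        α G₂ * (D * Q)                           ≡⟨ trans (cong (λ d → α G₂ * (d * Q)) D≡) (lemma₁ (α G₂) (N * N) Q) ⟩
        3 * Q * α G₂ * (N * N)                   ≤⟨ *-monoˡ-≤ (N * N) (α-bound Q m (suc-pred (N * Q * (N * Q)))) ⟩
        (Q * β + N * N) * order G * (N * N)      ≤⟨ *-monoˡ-≤ (N * N) (*-monoˡ-≤ (order G) (+-monoʳ-≤ (Q * β) N²≤)) ⟩
        (Q * β + suc p * D) * order G * (N * N)  ≡⟨ lemma₂ Q β (suc p * D) (order G) N ⟩
        (β * Q + suc p * D) * order G₂           ∎))
      where
      open ≤-Reasoning
      Q m : ℕ
      Q = suc q
      m = pred (N * Q * (N * Q))
      G G₂ : Graph
      G  = W n ^□ suc m
      G₂ = G □ W n □ W n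
      N²≤ : N * N ≤ suc p * D
      -- As `D` is `3 * (N * N)`, the error of `α-bound` amounts to `1 / (3 * Q)`, which is at most
      -- the given `suc p / Q`.
      N²≤ = ≤-trans (≤-trans (m≤n*m (N * N) 3) (≤-reflexive (sym D≡))) (m≤n*m D (suc p))
      lemma₁ : ∀ F n₂ Q → F * (3 * n₂ * Q) ≡ 3 * Q * F * n₂
      lemma₁ = solve-∀
      lemma₂ : ∀ Q β d P N → (Q * β + d) * P * (N * N) ≡ (β * Q + d) * (P * N * N)
      lemma₂ = solve-∀

-- The three sections colour parts of the `N * N` vertices of `W n □ W n`, and `deletions` leaves
-- `n + 3` of these uncoloured; the rest is `β`.
section-triangles : ∀ t → let n′ = 2 + t + (3 + t) ; N = 3 + n′ in
  ∀ β → β + (5 + n′) ≡ N * N → SectionTriangles n′ β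
section-triangles t β β+ G {S} ind u v w uv vw uw = +-cancelʳ-≤ (3 + n) _ _ (begin
  size u + size v + size w + (3 + n)        ≤⟨ +-monoʳ-≤ (size u + size v + size w) (deletions g) ⟩
  size u + size v + size w + Grid.total g   ≤⟨ three-sets (2 + t) (section n′ G S u) (section n′ G S v) (section n′ G S w) i₁ i₂ i₃ d₁₂ d₂₃ d₁₃ ⟩
  (1 + n) * (1 + n)                         ≡⟨ β+ ⟨
  β + (3 + n)                               ∎)
  where
  open ≤-Reasoning
  n n′ : ℕ
  n′ = 2 + t + (3 + t)
  n  = 2 + n′
  size : V G → ℕ
  size = sectionSize n′ G S
  i₁ = section-independent n′ G ind u
  i₂ = section-independent n′ G ind v
  i₃ = section-independent n′ G ind w
  d₁₂ = section-disjoint n′ G ind uv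
  d₂₃ = section-disjoint n′ G ind vw
  d₁₃ = section-disjoint n′ G ind uw
  g : Grid (3 + t)
  g = grid (2 + t) (section n′ G S u) (section n′ G S v) (section n′ G S w) i₁ i₂ i₃ d₁₂ d₂₃ d₁₃

theorem1p5 : ∀ (t : ℕ) → 3 ≤ t →
  𝓘 (W (2 * t + 1)) ≤ℝ fromℚ (+ (4 * t ^ 2 + 6 * t) / (3 * (2 + 2 * t) ^ 2))
theorem1p5 t 3≤t = limit-bound (2 + u + (3 + u)) {4 * t ^ 2 + 6 * t} (section-triangles u (4 * t ^ 2 + 6 * t) (β+ t u t≡))
  (3 * (2 + 2 * t) ^ 2) (length≡ t u t≡) (D≡ t u t≡)
  where
  -- Writing `t` as `3 + u` matches the index of `Grid (3 + u)`, for which `deletions` is stated.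
  u : ℕ
  u = t ∸ 3
  t≡ : t ≡ 3 + u
  t≡ = sym (m+[n∸m]≡n 3≤t)
  length≡ : ∀ t u → t ≡ 3 + u → 2 + (2 + u + (3 + u)) ≡ 2 * t + 1
  length≡ t u refl = lemma u
    where
    lemma : ∀ u → 2 + (2 + u + (3 + u)) ≡ 2 * (3 + u) + 1
    lemma = solve-∀
  β+ : ∀ t u → t ≡ 3 + u → 4 * t ^ 2 + 6 * t + (5 + (2 + u + (3 + u))) ≡ (3 + (2 + u + (3 + u))) * (3 + (2 + u + (3 + u)))
  β+ t u refl = lemma u
    where
    lemma : ∀ u → 4 * ((3 + u) * ((3 + u) * 1)) + 6 * (3 + u) + (5 + (2 + u + (3 + u))) ≡ (3 + (2 + u + (3 + u))) * (3 + (2 + u + (3 + u)))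
    lemma = solve-∀
  D≡ : ∀ t u → t ≡ 3 + u → 3 * (2 + 2 * t) ^ 2 ≡ 3 * ((1 + (2 + (2 + u + (3 + u)))) * (1 + (2 + (2 + u + (3 + u)))))
  D≡ t u refl = lemma u
    where
    lemma : ∀ u → 3 * ((2 + 2 * (3 + u)) * ((2 + 2 * (3 + u)) * 1)) ≡ 3 * ((1 + (2 + (2 + u + (3 + u)))) * (1 + (2 + (2 + u + (3 + u)))))
    lemma = solve-∀
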